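{- Let $a(n)$ denote the total area of all $(-1)$-Dyck paths of semi-length $n$. The generating function for the sequence $a(n)$ is given by $$V(x)=\sum_{n\geq 0} a(n)x^n=\frac{b(x) - c(x)\sqrt{1-4x+2x^2+x^4}}{(1- x)^2 (1 - 4 x + 2 x^2)^3 (1 - 3 x - x^2 - x^3)},$$ where $$b(x)=2 x - 23 x^2 + 107 x^3 - 262 x^4 + 359 x^5 - 256 x^6 + 82 x^7 - 5 x^8 - 10 x^9 + 6 x^{10},$$ $$c(x)=x - 10 x^2 + 41 x^3 - 89 x^4 + 108 x^5 - 73 x^6 + 18 x^7 + 2 x^8.$$
   Context: A Dyck path is a lattice path in the first quadrant that starts at the origin, ends on the $x$-axis, and consists of steps $U=(1,1)$ and $D=(1,-1)$ (never going below the $x$-axis). Its semi-length is its number of $U$ steps. A valley is an occurrence of two consecutive steps $DU$; the level of a valley is the $y$-coordinate of its lowest point. Let $\nu=(\nu_1,\dots,\nu_k)$ be the levels of all valleys of $P$, listed from left to right. A Dyck path is called $(-1)$-Dyck if it has at most one valley or if $\nu_{i+1}-\nu_i\ge -1$ for all $1\le i<k$. The area of a Dyck path is the sum of the $y$-coordinates of all lattice points visited by the path (equivalently, the area of the region between the path and the $x$-axis). In particular $a(0)=0$. The identity is one of formal power series, the square root being the one with constant term $1$. -}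

module Defs where

open import Agda.Builtin.FromNat public using (Number; fromNat)
open import Agda.Builtin.FromNeg public using (Negative; fromNeg)
open import Algebra.Bundles using (Ring)
import Algebra.Properties.Semiring.Sum as Sum
open import Data.Integer as ℤ using (ℤ; 0ℤ; -1ℤ; 1ℤ)
import Data.Integer.Literals as ℤ-Literals
import Data.Integer.Properties as ℤ
open import Data.Fin using (toℕ)
import Data.Fin.Properties as Fin
open import Data.List using (List; []; _∷_; cartesianProductWith; filter; foldl; foldr; length; map)
open import Data.List.Membership.Propositional using (_∈_)
open import Data.List.Membership.Propositional.Properties
  using (∈-cartesianProductWith⁺; ∈-filter⁺; ∈-filter⁻)
open import Data.List.Relation.Unary.All as All using (All; []; _∷_)
open import Data.List.Relation.Unary.AllPairs using ([]; _∷_)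
open import Data.List.Relation.Unary.Any using (here; there)
open import Data.List.Relation.Unary.Linked as Linked using (Linked)
open import Data.List.Relation.Unary.Unique.Propositional using (Unique)
import Data.List.Relation.Unary.Unique.Propositional.Properties as Unique
open import Data.Nat as ℕ using (ℕ; zero; suc)
import Data.Nat.Literals as ℕ-Literals
import Data.Nat.Properties as ℕ
open import Data.Product using (_×_; _,_; proj₂)
open import Data.Rational as ℚ using (ℚ; 0ℚ; 1ℚ; ½)
open import Data.Rational.Literals using (fromℤ)
import Data.Rational.Properties as ℚ
open import Data.Unit using (tt)
open import Function using (_⇔_; mk⇔; _∘_)
open import Relation.Binary.PropositionalEquality
open import Relation.Nullary using (Dec)
open import Relation.Nullary.Decidable using (_×-dec_)

instance
  numberℕ : Number ℕ
  numberℕ = ℕ-Literals.number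

  numberℤ : Number ℤ
  numberℤ = ℤ-Literals.number

  negativeℤ : Negative ℤ
  negativeℤ = ℤ-Literals.negative

------------------------------------------------------------------------
-- Lattice paths

data Step : Set where
  U D : Step

Path : Set
Path = List Step

infixl 6 _▹_

_▹_ : ℤ → Step → ℤ
y ▹ U = y ℤ.+ 1ℤ
y ▹ D = y ℤ.- 1ℤ

-- In the next two definitions the first argument is the y-coordinate
-- of the point at which the path starts.

ordinates : ℤ → Path → List ℤ
ordinates y []      = y ∷ []
ordinates y (s ∷ p) = y ∷ ordinates (y ▹ s) p

valleyLevels : ℤ → Path → List ℤ
valleyLevels y []          = []
valleyLevels y (U ∷ p)     = valleyLevels (y ▹ U) p
valleyLevels y (D ∷ [])    = []
valleyLevels y (D ∷ U ∷ p) = y ▹ D ∷ valleyLevels (y ▹ D) (U ∷ p)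
valleyLevels y (D ∷ D ∷ p) = valleyLevels (y ▹ D) (D ∷ p)

semilength : Path → ℕ
semilength []      = 0
semilength (U ∷ p) = suc (semilength p)
semilength (D ∷ p) = semilength p

IsDyck : Path → Set
IsDyck p = All (0ℤ ℤ.≤_) (ordinates 0ℤ p) × foldl _▹_ 0ℤ p ≡ 0ℤ

-- `Linked` relates consecutive entries only, hence holds of every list
-- with at most one entry.

IsMinusOneDyck : Path → Set
IsMinusOneDyck p =
  IsDyck p × Linked (λ ν ν′ → -1ℤ ℤ.≤ ν′ ℤ.- ν) (valleyLevels 0ℤ p)

isMinusOneDyck? : ∀ p → Dec (IsMinusOneDyck p)
isMinusOneDyck? p =
  (All.all? (0ℤ ℤ.≤?_) (ordinates 0ℤ p) ×-dec foldl _▹_ 0ℤ p ℤ.≟ 0ℤ)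
    ×-dec Linked.linked? (λ ν ν′ → -1ℤ ℤ.≤? ν′ ℤ.- ν) (valleyLevels 0ℤ p)

area : Path → ℤ
area p = foldr ℤ._+_ 0ℤ (ordinates 0ℤ p)

words : ℕ → List Path
words zero    = [] ∷ []
words (suc m) = cartesianProductWith _∷_ (U ∷ D ∷ []) (words m)

-- A path of semi-length n that returns to the x-axis has 2n steps, so
-- searching the words of that length misses nothing; see
-- `∈-minusOneDyckPaths` and `minusOneDyckPaths-unique`.

minusOneDyckPaths : ℕ → List Path
minusOneDyckPaths n =
  filter (λ p → isMinusOneDyck? p ×-dec semilength p ℕ.≟ n) (words (2 ℕ.* n))

a : ℕ → ℤ
a n = foldr ℤ._+_ 0ℤ (map area (minusOneDyckPaths n))

words-complete : ∀ p → p ∈ words (length p)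
words-complete []      = here refl
words-complete (U ∷ p) =
  ∈-cartesianProductWith⁺ _∷_ {xs = U ∷ D ∷ []} (here refl) (words-complete p)
words-complete (D ∷ p) =
  ∈-cartesianProductWith⁺ _∷_ {xs = U ∷ D ∷ []} (there (here refl)) (words-complete p)

words-unique : ∀ m → Unique (words m)
words-unique zero    = [] ∷ []
words-unique (suc m) =
  Unique.cartesianProductWith⁺ _∷_ (λ { refl → refl , refl })
    (((λ ()) ∷ []) ∷ [] ∷ []) (words-unique m)

swap : ∀ i j k → i ℤ.+ (j ℤ.+ k) ≡ i ℤ.+ k ℤ.+ j
swap i j k = trans (cong (λ l → i ℤ.+ l) (ℤ.+-comm j k)) (sym (ℤ.+-assoc i k j))

height+length : ∀ y p →
  foldl _▹_ y p ℤ.+ ℤ.+ length p ≡ y ℤ.+ ℤ.+ (2 ℕ.* semilength p)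
height+length y []      = refl
height+length y (U ∷ p) = begin
  foldl _▹_ (y ▹ U) p ℤ.+ (1ℤ ℤ.+ ℤ.+ length p)    ≡⟨ swap (foldl _▹_ _ p) 1ℤ (ℤ.+ length p) ⟩
  foldl _▹_ (y ▹ U) p ℤ.+ ℤ.+ length p ℤ.+ 1ℤ      ≡⟨ cong (ℤ._+ 1ℤ) (height+length (y ▹ U) p) ⟩
  y ℤ.+ 1ℤ ℤ.+ ℤ.+ (2 ℕ.* semilength p) ℤ.+ 1ℤ     ≡⟨ cong (ℤ._+ 1ℤ) (ℤ.+-assoc y 1ℤ _) ⟩
  y ℤ.+ ℤ.+ suc (2 ℕ.* semilength p) ℤ.+ 1ℤ        ≡⟨ swap y 1ℤ _ ⟨
  y ℤ.+ ℤ.+ suc (suc (2 ℕ.* semilength p))         ≡⟨ cong (λ k → y ℤ.+ ℤ.+ k) (ℕ.*-suc 2 (semilength p)) ⟨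
  y ℤ.+ ℤ.+ (2 ℕ.* suc (semilength p))             ∎
  where open ≡-Reasoning
height+length y (D ∷ p) = begin
  foldl _▹_ (y ▹ D) p ℤ.+ (1ℤ ℤ.+ ℤ.+ length p)    ≡⟨ swap (foldl _▹_ _ p) 1ℤ (ℤ.+ length p) ⟩
  foldl _▹_ (y ▹ D) p ℤ.+ ℤ.+ length p ℤ.+ 1ℤ      ≡⟨ cong (ℤ._+ 1ℤ) (height+length (y ▹ D) p) ⟩
  y ℤ.+ -1ℤ ℤ.+ ℤ.+ (2 ℕ.* semilength p) ℤ.+ 1ℤ    ≡⟨ swap (y ℤ.- 1ℤ) 1ℤ _ ⟨
  y ℤ.+ -1ℤ ℤ.+ ℤ.+ suc (2 ℕ.* semilength p)       ≡⟨ ℤ.+-assoc y -1ℤ _ ⟩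
  y ℤ.+ ℤ.+ (2 ℕ.* semilength p)                   ∎
  where open ≡-Reasoning

dyck-length : ∀ {p} → IsDyck p → length p ≡ 2 ℕ.* semilength p
dyck-length {p} (_ , end) = ℤ.+-injective
  (trans (cong (ℤ._+ ℤ.+ length p) (sym end)) (height+length 0ℤ p))

∈-minusOneDyckPaths : ∀ {n p} →
  p ∈ minusOneDyckPaths n ⇔ (IsMinusOneDyck p × semilength p ≡ n)
∈-minusOneDyckPaths {n} {p} = mk⇔ (proj₂ ∘ ∈-filter⁻ P? {xs = words (2 ℕ.* n)}) complete
  where
  P? = λ p → isMinusOneDyck? p ×-dec semilength p ℕ.≟ n
  complete : IsMinusOneDyck p × semilength p ≡ n → p ∈ minusOneDyckPaths n
  complete ((dyck , linked) , refl) = ∈-filter⁺ P?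
    (subst (λ m → p ∈ words m) (dyck-length dyck) (words-complete p))
    ((dyck , linked) , refl)

minusOneDyckPaths-unique : ∀ n → Unique (minusOneDyckPaths n)
minusOneDyckPaths-unique n = Unique.filter⁺ _ (words-unique (2 ℕ.* n))

------------------------------------------------------------------------
-- Formal power series over ℚ, as coefficient sequences

open Sum (Ring.semiring ℚ.+-*-ring) using (sum; sum-cong-≗)

Series : Set
Series = ℕ → ℚ

tail : Series → Series
tail f n = f (suc n)

poly : List ℤ → Series
poly []       n       = 0ℚ
poly (k ∷ ks) zero    = fromℤ k
poly (k ∷ ks) (suc n) = poly ks n

infixl 6 _-_
infixl 7 _*_ _÷_
infixr 8 _^_
infix  9 √_

_-_ : Series → Series → Series
(f - g) n = f n ℚ.- g n

_*_ : Series → Series → Series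
(f * g) n = sum {suc n} λ i → f (toℕ i) ℚ.* g (n ℕ.∸ toℕ i)

_^_ : Series → ℕ → Series
f ^ zero  = poly (1 ∷ [])
f ^ suc k = f * f ^ k

-- Long division: if f = g q and q = q₀ + x q′ then f′ - q₀ g′ = g q′,
-- where f′ and g′ are the tails of f and g.

remainder : (f g : Series) .{{_ : ℚ.NonZero (g 0)}} → Series
remainder f g n = tail f n ℚ.- (f 0 ℚ.÷ g 0) ℚ.* tail g n

_÷_ : (f g : Series) .{{_ : ℚ.NonZero (g 0)}} → Series
(f ÷ g) zero    = f 0 ℚ.÷ g 0
(f ÷ g) (suc n) = (remainder f g ÷ g) n

-- The square root with constant term 1 of a series f with constant
-- term 1.  Writing it as 1 + x t, the series t is the fixed point of
-- t = ½ (f′ - x t²), where f′ is the tail of f; the k-th iterate below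
-- agrees with t in the first k coefficients.

rootTail : Series → ℕ → Series
rootTail f zero    n       = 0ℚ
rootTail f (suc k) zero    = ½ ℚ.* f 1
rootTail f (suc k) (suc n) =
  ½ ℚ.* (tail f (suc n) ℚ.- (rootTail f k * rootTail f k) n)

√_ : Series → Series
(√ f) zero    = 1ℚ
(√ f) (suc n) = rootTail f (suc n) n

÷-*-cancel : ∀ f g .{{_ : ℚ.NonZero (g 0)}} → (f ÷ g) * g ≗ f
÷-*-cancel f g zero    = begin
  (f 0 ℚ.* ℚ.1/ g 0) ℚ.* g 0 ℚ.+ 0ℚ  ≡⟨ ℚ.+-identityʳ _ ⟩
  (f 0 ℚ.* ℚ.1/ g 0) ℚ.* g 0         ≡⟨ ℚ.*-assoc (f 0) _ _ ⟩
  f 0 ℚ.* (ℚ.1/ g 0 ℚ.* g 0)         ≡⟨ cong (f 0 ℚ.*_) (ℚ.*-inverseˡ (g 0)) ⟩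
  f 0 ℚ.* 1ℚ                         ≡⟨ ℚ.*-identityʳ (f 0) ⟩
  f 0                                ∎
  where open ≡-Reasoning
÷-*-cancel f g (suc n) = begin
  m ℚ.+ (tail (f ÷ g) * g) n    ≡⟨ cong (m ℚ.+_) (÷-*-cancel (remainder f g) g n) ⟩
  m ℚ.+ (tail f n ℚ.- m)        ≡⟨ cong (m ℚ.+_) (ℚ.+-comm (tail f n) (ℚ.- m)) ⟩
  m ℚ.+ (ℚ.- m ℚ.+ tail f n)    ≡⟨ ℚ.+-assoc m (ℚ.- m) (tail f n) ⟨
  (m ℚ.- m) ℚ.+ tail f n        ≡⟨ cong (ℚ._+ tail f n) (ℚ.+-inverseʳ m) ⟩
  0ℚ ℚ.+ tail f n               ≡⟨ ℚ.+-identityˡ (tail f n) ⟩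
  tail f n                      ∎
  where
  open ≡-Reasoning
  m = (f 0 ℚ.÷ g 0) ℚ.* tail g n

square-cong-upTo : ∀ f g n → (∀ i → i ℕ.≤ n → f i ≡ g i) → (f * f) n ≡ (g * g) n
square-cong-upTo f g n f≡g = sum-cong-≗ {suc n} λ i →
  cong₂ ℚ._*_ (f≡g (toℕ i) (Fin.toℕ≤pred[n] i)) (f≡g (n ℕ.∸ toℕ i) (ℕ.m∸n≤m n (toℕ i)))

*-suc : ∀ f g n → (f * g) (suc n) ≡ (f * tail g) n ℚ.+ f (suc n) ℚ.* g 0
*-suc f g zero    = begin
  x ℚ.+ (y ℚ.+ 0ℚ)    ≡⟨ cong (x ℚ.+_) (ℚ.+-comm y 0ℚ) ⟩
  x ℚ.+ (0ℚ ℚ.+ y)    ≡⟨ ℚ.+-assoc x 0ℚ y ⟨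
  x ℚ.+ 0ℚ ℚ.+ y      ∎
  where
  open ≡-Reasoning
  x = f 0 ℚ.* g 1
  y = f 1 ℚ.* g 0
*-suc f g (suc n) =
  trans (cong (f 0 ℚ.* g (suc (suc n)) ℚ.+_) (*-suc (tail f) g n))
        (sym (ℚ.+-assoc (f 0 ℚ.* g (suc (suc n))) _ _))

rootTail-stable : ∀ f {i k l} → i ℕ.< k → i ℕ.< l → rootTail f k i ≡ rootTail f l i
rootTail-stable f {zero}  {suc k} {suc l} _           _           = refl
rootTail-stable f {suc i} {suc k} {suc l} (ℕ.s≤s i<k) (ℕ.s≤s i<l) =
  cong (λ q → ½ ℚ.* (f (suc (suc i)) ℚ.- q))
    (square-cong-upTo (rootTail f k) (rootTail f l) i λ j j≤i →
      rootTail-stable f (ℕ.≤-<-trans j≤i i<k) (ℕ.≤-<-trans j≤i i<l))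

½+½ : ∀ q → ½ ℚ.* q ℚ.+ ½ ℚ.* q ≡ q
½+½ q = trans (sym (ℚ.*-distribʳ-+ q ½ ½)) (ℚ.*-identityˡ q)

√-square : ∀ f → f 0 ≡ 1ℚ → √ f * √ f ≗ f
√-square f f₀≡1 zero          = sym f₀≡1
√-square f f₀≡1 (suc zero)    = begin
  1ℚ ℚ.* t ℚ.+ (t ℚ.* 1ℚ ℚ.+ 0ℚ)  ≡⟨ cong₂ ℚ._+_ (ℚ.*-identityˡ t) (ℚ.+-identityʳ _) ⟩
  t ℚ.+ t ℚ.* 1ℚ                  ≡⟨ cong (t ℚ.+_) (ℚ.*-identityʳ t) ⟩
  t ℚ.+ t                         ≡⟨ ½+½ (f 1) ⟩
  f 1                             ∎
  where
  open ≡-Reasoning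
  t = ½ ℚ.* f 1
√-square f f₀≡1 (suc (suc n)) = begin
  1ℚ ℚ.* u ℚ.+ (t * √ f) (suc n)     ≡⟨ cong₂ ℚ._+_ (ℚ.*-identityˡ u) (*-suc t (√ f) n) ⟩
  u ℚ.+ ((t * t) n ℚ.+ u ℚ.* 1ℚ)     ≡⟨ cong (λ q → u ℚ.+ ((t * t) n ℚ.+ q)) (ℚ.*-identityʳ u) ⟩
  u ℚ.+ ((t * t) n ℚ.+ u)            ≡⟨ cong (u ℚ.+_) (ℚ.+-comm ((t * t) n) u) ⟩
  u ℚ.+ (u ℚ.+ (t * t) n)            ≡⟨ ℚ.+-assoc u u _ ⟨
  u ℚ.+ u ℚ.+ (t * t) n              ≡⟨ cong (ℚ._+ (t * t) n) (½+½ (f (suc (suc n)) ℚ.- w)) ⟩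
  f (suc (suc n)) ℚ.- w ℚ.+ (t * t) n
    ≡⟨ cong (λ q → f (suc (suc n)) ℚ.- w ℚ.+ q) (square-cong-upTo t (rootTail f (suc n)) n agree) ⟩
  f (suc (suc n)) ℚ.- w ℚ.+ w        ≡⟨ ℚ.+-assoc (f (suc (suc n))) (ℚ.- w) w ⟩
  f (suc (suc n)) ℚ.+ (ℚ.- w ℚ.+ w)  ≡⟨ cong (f (suc (suc n)) ℚ.+_) (ℚ.+-inverseˡ w) ⟩
  f (suc (suc n)) ℚ.+ 0ℚ             ≡⟨ ℚ.+-identityʳ _ ⟩
  f (suc (suc n))                    ∎
  where
  open ≡-Reasoning
  t = tail (√ f)
  u = t (suc n)
  w = (rootTail f (suc n) * rootTail f (suc n)) n
  agree : ∀ i → i ℕ.≤ n → t i ≡ rootTail f (suc n) i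
  agree i i≤n = rootTail-stable f ℕ.≤-refl (ℕ.s≤s i≤n)

b c : Series
b = poly (0 ∷ 2 ∷ -23 ∷ 107 ∷ -262 ∷ 359 ∷ -256 ∷ 82 ∷ -5 ∷ -10 ∷ 6 ∷ [])
c = poly (0 ∷ 1 ∷ -10 ∷ 41 ∷ -89 ∷ 108 ∷ -73 ∷ 18 ∷ 2 ∷ [])

V : Series
V n = fromℤ (a n)

{-# OPTIONS --safe #-}
module Submission where

-- Cut a nonempty Dyck path at its first return, as U A D B.  If B is empty,
-- the valleys are those of A, raised by one.  If B is nonempty, the valley
-- between A and B has level 0: the step from it into B is unconstrained, since
-- levels are nonnegative, and the step into it from the last valley of A is
-- admissible iff that valley has level 0 in A.  Call a (-1)-Dyck path low if
-- its last valley, if any, has level 0; equivalently, if its valley levels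
-- followed by the sentinel -1 still never drop by more than 1.  In this form
-- the same analysis applies to (-1)-Dyck paths and to low ones: a path
-- U A D B with B nonempty belongs to the class iff A is low and B belongs to
-- the class.  The path U A D is (-1)-Dyck iff A is, and it is low iff A has no
-- valley, that is, iff A is a pyramid (`steady-node`, `steady-hill`).  As the
-- decomposition is unique (`node-injective`), this gives a bijection
-- (`paths-decompose`).
--
-- Let F and G = 1 + H count all and low paths by semi-length, E = F - 1, and
-- let k = 1 / (1 - x) count pyramids.  Then
--   H = x (k + G H)   and   E = x (F + G E).
-- Raising a path of semi-length n by one increases its area by its number
-- 2n + 1 of lattice points, and area is additive over the decomposition, so
-- with L(v, f) = v + 2 x f' + f (`raised`) the area series p, w, v of pyramids, low paths
-- and all paths satisfy (`area-equation`)
--   p = x L(p, k),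
--   w = x (L(p, k) + L(w, G) H + G w),
--   v = x (L(v, F) + L(w, G) E + G v).
--
-- The quadratic for H says that (1 - x)^2 - 2 x (1 - x) H squares to
-- 1 - 4 x + 2 x^2 + x^4, hence is the square root in the claim.  The other
-- equations are linear in their unknowns.  The series (P + Q r) / d, with r
-- that square root and P, Q, d polynomials, are closed under sums, products,
-- x d/dx and the solution of linear equations (module `Surds`), so the system
-- is solved by explicit computation with triples of coefficient lists
-- (`area-closed-form`), and the triple found for v is the one claimed.

open import Defs
open import Algebra.Bundles using (CommutativeRing; Ring)
import Algebra.Construct.Pointwise as Pointwise
import Algebra.Properties.CommutativeSemigroup as CommutativeSemigroup
import Algebra.Properties.Ring as RingProperties
import Algebra.Properties.Semiring.Sum as Sum
import Algebra.Solver.Ring as RingSolver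
open import Algebra.Solver.Ring.AlmostCommutativeRing
  using (fromCommutativeRing; _-Raw-AlmostCommutative⟶_)
open import Data.Fin as Fin using (Fin; toℕ; fromℕ<)
import Data.Fin.Properties as Fin
open import Data.Integer as ℤ using (ℤ; 0ℤ; 1ℤ; -1ℤ)
import Data.Integer.Properties as ℤ
open import Data.List
  using (List; []; _∷_; _++_; map; foldl; foldr; length; filter; concat; tabulate; cartesianProduct)
open import Data.List.Membership.Propositional using (_∈_)
open import Data.List.Membership.Propositional.Properties
  using ( ∈-filter⁺; ∈-filter⁻; ∈-map⁺; ∈-map⁻; ∈-++⁺ˡ; ∈-++⁺ʳ; ∈-++⁻; ∈-concat⁺′; ∈-concat⁻′
        ; ∈-tabulate⁺; ∈-tabulate⁻; ∈-cartesianProduct⁺; ∈-cartesianProduct⁻ )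
open import Data.List.Membership.Propositional.Properties.WithK using (unique∧set⇒bag)
import Data.List.Properties as List
open import Data.List.Relation.Binary.BagAndSetEquality using (∼bag⇒↭)
open import Data.List.Relation.Binary.Disjoint.Propositional using (Disjoint)
open import Data.List.Relation.Binary.Permutation.Propositional as Perm using (_↭_)
open import Data.List.Relation.Unary.All as All using (All; []; _∷_)
import Data.List.Relation.Unary.All.Properties as All
open import Data.List.Relation.Unary.AllPairs using ([]; _∷_)
import Data.List.Relation.Unary.AllPairs.Properties as AllPairs
open import Data.List.Relation.Unary.Any using (Any; here; there; any?)
open import Data.List.Relation.Unary.Linked as Linked using (Linked; []; [-]; _∷_)
import Data.List.Relation.Unary.Linked.Properties as Linked
open import Data.List.Relation.Unary.Unique.Propositional using (Unique)
import Data.List.Relation.Unary.Unique.Propositional.Properties as Unique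
open import Data.Maybe using (Maybe; just; nothing)
open import Data.Nat as ℕ using (ℕ; zero; suc; nonZero)
import Data.Nat.Properties as ℕ
open import Data.Product using (_×_; _,_; proj₁; proj₂; map₁; ∃; uncurry)
open import Data.Product.Properties using (,-injectiveˡ)
open import Data.Rational as ℚ using (ℚ; 0ℚ; 1ℚ)
open import Data.Rational.Literals using (fromℤ)
import Data.Rational.Properties as ℚ
import Data.Rational.Solver as ℚ-Solver
open import Data.Sum using (inj₁; inj₂)
open import Data.Unit using (tt)
open import Function using (_⇔_; mk⇔; _∘_; Equivalence)
open import Level using (0ℓ)
open import Relation.Binary.PropositionalEquality
  using (_≡_; _≢_; _≗_; refl; sym; trans; cong; cong₂; subst; module ≡-Reasoning)
import Relation.Binary.Reasoning.Setoid as SetoidReasoning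
open import Relation.Nullary using (Dec; yes; no; ¬?; contradiction)
open import Relation.Nullary.Decidable using (True; toWitness; _×-dec_)

-- Polynomials and quadratic surds

-- Arities for the ring solvers: named constants, as the overloading of a
-- literal is resolved too late for the solvers to compute with it.
two three four five six seven eight nine : ℕ
two   = 2
three = 3
four  = 4
five  = 5
six   = 6
seven = 7
eight = 8
nine  = 9

-- Polynomials in x over ℤ are lists of coefficients, the constant one first;
-- trailing zeros are allowed.

infixl 6 _⊕_
infixl 7 _⊗_

_⊕_ : List ℤ → List ℤ → List ℤ
[]      ⊕ l       = l
(i ∷ k) ⊕ []      = i ∷ k
(i ∷ k) ⊕ (j ∷ l) = i ℤ.+ j ∷ k ⊕ l

⊖_ : List ℤ → List ℤ
⊖_ = map (ℤ.-_)

_⊗_ : List ℤ → List ℤ → List ℤ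
[]      ⊗ l = []
(i ∷ k) ⊗ l = map (i ℤ.*_) l ⊕ (0 ∷ k ⊗ l)

-- The derivation x d/dx, by the rule that it maps i + x k to x k + x (x dk/dx).
θₗ : List ℤ → List ℤ
θₗ []      = []
θₗ (i ∷ k) = 0 ∷ k ⊕ θₗ k

infix 4 _≃_ _≃?_

-- Equality up to trailing zeros.
_≃_ : List ℤ → List ℤ → Set
k ≃ l = All (_≡ 0ℤ) (k ⊕ ⊖ l)

_≃?_ : ∀ k l → Dec (k ≃ l)
k ≃? l = All.all? (ℤ._≟ 0ℤ) (k ⊕ ⊖ l)

-- A formal fraction (rat + irr √Δ) / den, neither reduced nor required to have
-- a nonzero denominator.
record Surd : Set where
  constructor _+[_]√/_
  field rat irr den : List ℤ
open Surd

infixl 6 _+ˢ_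

_+ˢ_ : Surd → Surd → Surd
(p +[ q ]√/ d) +ˢ (p′ +[ q′ ]√/ d′) =
  (p ⊗ d′ ⊕ p′ ⊗ d) +[ q ⊗ d′ ⊕ q′ ⊗ d ]√/ (d ⊗ d′)

mulˢ : (Δ : List ℤ) → Surd → Surd → Surd
mulˢ Δ (p +[ q ]√/ d) (p′ +[ q′ ]√/ d′) =
  (p ⊗ p′ ⊕ q ⊗ q′ ⊗ Δ) +[ p ⊗ q′ ⊕ q ⊗ p′ ]√/ (d ⊗ d′)

-- The solution f of f = u + v f.  For v = (p + q √Δ) / d the equation reads
-- (m - q √Δ) f = d u with m = d - p; multiply it by m + q √Δ.
fixˢ : (Δ : List ℤ) (u v : Surd) → Surd
fixˢ Δ (p′ +[ q′ ]√/ d′) (p +[ q ]√/ d) =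
  (d ⊗ (m ⊗ p′ ⊕ q ⊗ q′ ⊗ Δ)) +[ d ⊗ (m ⊗ q′ ⊕ q ⊗ p′) ]√/ ((m ⊗ m ⊕ ⊖ (q ⊗ q ⊗ Δ)) ⊗ d′)
  where m = d ⊕ ⊖ p

-- The quotient rule, with θ √Δ = θ Δ √Δ / (2 Δ).
θˢ : (Δ : List ℤ) → Surd → Surd
θˢ Δ (p +[ q ]√/ d) =
  ((2 ∷ []) ⊗ Δ ⊗ (d ⊗ θₗ p ⊕ ⊖ (θₗ d ⊗ p)))
    +[ (2 ∷ []) ⊗ Δ ⊗ (d ⊗ θₗ q ⊕ ⊖ (θₗ d ⊗ q)) ⊕ d ⊗ q ⊗ θₗ Δ ]√/
  ((2 ∷ []) ⊗ (Δ ⊗ (d ⊗ d)))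

-- A commutative ring under ℤ[x] with a derivation θ extending x d/dx and a
-- square root r of Δ, in which nonzero polynomials can be cancelled.
record SurdRing (Δ : List ℤ) : Set₁ where
  field
    ring : CommutativeRing 0ℓ 0ℓ
  open CommutativeRing ring renaming (_*_ to _·_) hiding (_-_; ring) public
  field
    ⟦_⟧       : List ℤ → Carrier
    ⟦⟧-⊕      : ∀ k l → ⟦ k ⊕ l ⟧ ≈ ⟦ k ⟧ + ⟦ l ⟧
    ⟦⟧-⊖      : ∀ k → ⟦ ⊖ k ⟧ ≈ - ⟦ k ⟧
    ⟦⟧-⊗      : ∀ k l → ⟦ k ⊗ l ⟧ ≈ ⟦ k ⟧ · ⟦ l ⟧
    ⟦⟧-1      : ⟦ 1 ∷ [] ⟧ ≈ 1#
    ⟦⟧-0      : ∀ {k} → All (_≡ 0ℤ) k → ⟦ k ⟧ ≈ 0#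
    ⟦⟧-cancel : ∀ {k} → Any (_≢ 0ℤ) k → ∀ f g → ⟦ k ⟧ · f ≈ ⟦ k ⟧ · g → f ≈ g
    θ         : Carrier → Carrier
    θ-cong    : ∀ {f g} → f ≈ g → θ f ≈ θ g
    θ-+       : ∀ f g → θ (f + g) ≈ θ f + θ g
    θ-·       : ∀ f g → θ (f · g) ≈ θ f · g + f · θ g
    ⟦⟧-θ      : ∀ k → ⟦ θₗ k ⟧ ≈ θ ⟦ k ⟧
    r         : Carrier
    r²≈Δ      : r · r ≈ ⟦ Δ ⟧

module Surds {Δ : List ℤ} (R : SurdRing Δ) where

  open SurdRing R renaming (refl to ≈-refl; sym to ≈-sym; trans to ≈-trans)

  const-* : ∀ i j → ⟦ i ℤ.* j ∷ [] ⟧ ≈ ⟦ i ∷ [] ⟧ · ⟦ j ∷ [] ⟧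
  const-* i j = ≈-trans
    (reflexive (cong (λ m → ⟦ m ∷ [] ⟧) (sym (ℤ.+-identityʳ (i ℤ.* j)))))
    (⟦⟧-⊗ (i ∷ []) (j ∷ []))

  -- The ring solver works over the constant polynomials.
  constants : ℤ.+-*-rawRing -Raw-AlmostCommutative⟶ fromCommutativeRing ring
  constants = record
    { ⟦_⟧    = λ i → ⟦ i ∷ [] ⟧
    ; +-homo = λ i j → ⟦⟧-⊕ (i ∷ []) (j ∷ [])
    ; *-homo = const-*
    ; -‿homo = λ i → ⟦⟧-⊖ (i ∷ [])
    ; 0-homo = ⟦⟧-0 (refl ∷ [])
    ; 1-homo = ⟦⟧-1
    }

  coeff≟ : ∀ i j → Maybe (⟦ i ∷ [] ⟧ ≈ ⟦ j ∷ [] ⟧)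
  coeff≟ i j with i ℤ.≟ j
  ... | yes refl = just ≈-refl
  ... | no  _    = nothing

  open RingSolver ℤ.+-*-rawRing (fromCommutativeRing ring) constants coeff≟
    using (solve; _:=_; _:+_; _:*_; _:-_; :-_; con)
  open SetoidReasoning setoid

  ⟦⟧-− : ∀ k l → ⟦ k ⊕ ⊖ l ⟧ ≈ ⟦ k ⟧ + - ⟦ l ⟧
  ⟦⟧-− k l = ≈-trans (⟦⟧-⊕ k (⊖ l)) (+-congˡ (⟦⟧-⊖ l))

  ⟦⟧-≃ : ∀ k l → {True (k ≃? l)} → ⟦ k ⟧ ≈ ⟦ l ⟧
  ⟦⟧-≃ k l {k≃l} = begin
    ⟦ k ⟧                       ≈⟨ solve two (λ x y → x := (x :+ :- y) :+ y) ≈-refl ⟦ k ⟧ ⟦ l ⟧ ⟩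
    (⟦ k ⟧ + - ⟦ l ⟧) + ⟦ l ⟧   ≈⟨ +-congʳ (≈-trans (≈-sym (⟦⟧-− k l)) (⟦⟧-0 (toWitness k≃l))) ⟩
    0# + ⟦ l ⟧                  ≈⟨ +-identityˡ ⟦ l ⟧ ⟩
    ⟦ l ⟧                       ∎

  ⟦⟧-⊗⊕⊗ : ∀ k l m n → ⟦ k ⊗ l ⊕ m ⊗ n ⟧ ≈ ⟦ k ⟧ · ⟦ l ⟧ + ⟦ m ⟧ · ⟦ n ⟧
  ⟦⟧-⊗⊕⊗ k l m n = ≈-trans (⟦⟧-⊕ (k ⊗ l) (m ⊗ n)) (+-cong (⟦⟧-⊗ k l) (⟦⟧-⊗ m n))

  ⟦⟧-⊗−⊗ : ∀ k l m n → ⟦ k ⊗ l ⊕ ⊖ (m ⊗ n) ⟧ ≈ ⟦ k ⟧ · ⟦ l ⟧ + - (⟦ m ⟧ · ⟦ n ⟧)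
  ⟦⟧-⊗−⊗ k l m n = ≈-trans (⟦⟧-− (k ⊗ l) (m ⊗ n)) (+-cong (⟦⟧-⊗ k l) (-‿cong (⟦⟧-⊗ m n)))

  infix 4 _≋_

  -- The element f is the value of the fraction s, stated without division.
  record _≋_ (f : Carrier) (s : Surd) : Set where
    constructor surd
    field equation : ⟦ den s ⟧ · f ≈ ⟦ rat s ⟧ + ⟦ irr s ⟧ · r

  ≋-resp : ∀ {f g s} → f ≈ g → f ≋ s → g ≋ s
  ≋-resp f≈g (surd eq) = surd (≈-trans (*-congˡ (≈-sym f≈g)) eq)

  ≋-⟦⟧ : ∀ k → ⟦ k ⟧ ≋ k +[ [] ]√/ (1 ∷ [])
  ≋-⟦⟧ k = surd (begin
    ⟦ 1 ∷ [] ⟧ · ⟦ k ⟧       ≈⟨ solve two (λ x y → con 1 :* x := x :+ con 0 :* y) ≈-refl ⟦ k ⟧ r ⟩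
    ⟦ k ⟧ + ⟦ 0 ∷ [] ⟧ · r   ≈⟨ +-congˡ (*-congʳ (≈-trans (⟦⟧-0 (refl ∷ [])) (≈-sym (⟦⟧-0 [])))) ⟩
    ⟦ k ⟧ + ⟦ [] ⟧ · r       ∎)

  ≋-+ : ∀ {f g s t} → f ≋ s → g ≋ t → f + g ≋ s +ˢ t
  ≋-+ {f} {g} {p +[ q ]√/ d} {p′ +[ q′ ]√/ d′} (surd eq) (surd eq′) = surd (begin
    ⟦ d ⊗ d′ ⟧ · (f + g)                     ≈⟨ *-congʳ (⟦⟧-⊗ d d′) ⟩
    ⟦ d ⟧ · ⟦ d′ ⟧ · (f + g)
      ≈⟨ solve four (λ d e f g → d :* e :* (f :+ g) := d :* f :* e :+ e :* g :* d) ≈-refl ⟦ d ⟧ ⟦ d′ ⟧ f g ⟩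
    ⟦ d ⟧ · f · ⟦ d′ ⟧ + ⟦ d′ ⟧ · g · ⟦ d ⟧    ≈⟨ +-cong (*-congʳ eq) (*-congʳ eq′) ⟩
    (⟦ p ⟧ + ⟦ q ⟧ · r) · ⟦ d′ ⟧ + (⟦ p′ ⟧ + ⟦ q′ ⟧ · r) · ⟦ d ⟧
      ≈⟨ solve seven (λ p q d p′ q′ d′ r → (p :+ q :* r) :* d′ :+ (p′ :+ q′ :* r) :* d
            := (p :* d′ :+ p′ :* d) :+ (q :* d′ :+ q′ :* d) :* r) ≈-refl
            ⟦ p ⟧ ⟦ q ⟧ ⟦ d ⟧ ⟦ p′ ⟧ ⟦ q′ ⟧ ⟦ d′ ⟧ r ⟩
    (⟦ p ⟧ · ⟦ d′ ⟧ + ⟦ p′ ⟧ · ⟦ d ⟧) + (⟦ q ⟧ · ⟦ d′ ⟧ + ⟦ q′ ⟧ · ⟦ d ⟧) · r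
      ≈⟨ +-cong (⟦⟧-⊗⊕⊗ p d′ p′ d) (*-congʳ (⟦⟧-⊗⊕⊗ q d′ q′ d)) ⟨
    ⟦ p ⊗ d′ ⊕ p′ ⊗ d ⟧ + ⟦ q ⊗ d′ ⊕ q′ ⊗ d ⟧ · r  ∎)

  ≋-· : ∀ {f g s t} → f ≋ s → g ≋ t → f · g ≋ mulˢ Δ s t
  ≋-· {f} {g} {p +[ q ]√/ d} {p′ +[ q′ ]√/ d′} (surd eq) (surd eq′) = surd (begin
    ⟦ d ⊗ d′ ⟧ · (f · g)                     ≈⟨ *-congʳ (⟦⟧-⊗ d d′) ⟩
    ⟦ d ⟧ · ⟦ d′ ⟧ · (f · g)
      ≈⟨ solve four (λ d e f g → d :* e :* (f :* g) := d :* f :* (e :* g)) ≈-refl ⟦ d ⟧ ⟦ d′ ⟧ f g ⟩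
    ⟦ d ⟧ · f · (⟦ d′ ⟧ · g)                 ≈⟨ *-cong eq eq′ ⟩
    (⟦ p ⟧ + ⟦ q ⟧ · r) · (⟦ p′ ⟧ + ⟦ q′ ⟧ · r)
      ≈⟨ solve five (λ p q p′ q′ r → (p :+ q :* r) :* (p′ :+ q′ :* r)
            := (p :* p′ :+ q :* q′ :* (r :* r)) :+ (p :* q′ :+ q :* p′) :* r) ≈-refl ⟦ p ⟧ ⟦ q ⟧ ⟦ p′ ⟧ ⟦ q′ ⟧ r ⟩
    (⟦ p ⟧ · ⟦ p′ ⟧ + ⟦ q ⟧ · ⟦ q′ ⟧ · (r · r)) + (⟦ p ⟧ · ⟦ q′ ⟧ + ⟦ q ⟧ · ⟦ p′ ⟧) · r
      ≈⟨ +-congʳ (+-congˡ (*-cong (≈-sym (⟦⟧-⊗ q q′)) r²≈Δ)) ⟩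
    (⟦ p ⟧ · ⟦ p′ ⟧ + ⟦ q ⊗ q′ ⟧ · ⟦ Δ ⟧) + (⟦ p ⟧ · ⟦ q′ ⟧ + ⟦ q ⟧ · ⟦ p′ ⟧) · r
      ≈⟨ +-cong (⟦⟧-⊗⊕⊗ p p′ (q ⊗ q′) Δ) (*-congʳ (⟦⟧-⊗⊕⊗ p q′ q p′)) ⟨
    ⟦ p ⊗ p′ ⊕ q ⊗ q′ ⊗ Δ ⟧ + ⟦ p ⊗ q′ ⊕ q ⊗ p′ ⟧ · r  ∎)

  ≋-fix : ∀ {f u v s t} → u ≋ s → v ≋ t → f ≈ u + v · f → f ≋ fixˢ Δ s t
  ≋-fix {f} {u} {v} {p′ +[ q′ ]√/ d′} {p +[ q ]√/ d} (surd eq′) (surd eq) fix = surd (begin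
    ⟦ (m ⊗ m ⊕ ⊖ (q ⊗ q ⊗ Δ)) ⊗ d′ ⟧ · f
      ≈⟨ *-congʳ (≈-trans (⟦⟧-⊗ (m ⊗ m ⊕ ⊖ (q ⊗ q ⊗ Δ)) d′) (*-congʳ (≈-trans
           (⟦⟧-⊗−⊗ m m (q ⊗ q) Δ)
           (+-cong (*-cong m≈ m≈) (-‿cong (*-cong (⟦⟧-⊗ q q) (≈-sym r²≈Δ))))))) ⟩
    ((E + - P) · (E + - P) + - (Q · Q · (r · r))) · E′ · f
      ≈⟨ solve six (λ p q d e f r → ((d :+ :- p) :* (d :+ :- p) :+ :- (q :* q :* (r :* r))) :* e :* f
            := ((d :+ :- p) :+ q :* r) :* e :* (d :* f :+ :- ((p :+ q :* r) :* f))) ≈-refl P Q E E′ f r ⟩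
    ((E + - P) + Q · r) · E′ · (E · f + - ((P + Q · r) · f))
      ≈⟨ *-congˡ linear ⟩
    ((E + - P) + Q · r) · E′ · (E · u)
      ≈⟨ solve four (λ x e d u → x :* e :* (d :* u) := d :* (x :* (e :* u))) ≈-refl
           ((E + - P) + Q · r) E′ E u ⟩
    E · (((E + - P) + Q · r) · (E′ · u))
      ≈⟨ *-congˡ (*-cong (+-congʳ (≈-sym m≈)) eq′) ⟩
    E · ((M + Q · r) · (P′ + Q′ · r))
      ≈⟨ solve six (λ d m q p′ q′ r → d :* ((m :+ q :* r) :* (p′ :+ q′ :* r))
            := d :* (m :* p′ :+ q :* q′ :* (r :* r)) :+ d :* (m :* q′ :+ q :* p′) :* r) ≈-refl
            E M Q P′ Q′ r ⟩
    E · (M · P′ + Q · Q′ · (r · r)) + E · (M · Q′ + Q · P′) · r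
      ≈⟨ +-congʳ (*-congˡ (+-congˡ (*-cong (≈-sym (⟦⟧-⊗ q q′)) r²≈Δ))) ⟩
    E · (M · P′ + ⟦ q ⊗ q′ ⟧ · ⟦ Δ ⟧) + E · (M · Q′ + Q · P′) · r
      ≈⟨ +-cong (*-congˡ (⟦⟧-⊗⊕⊗ m p′ (q ⊗ q′) Δ)) (*-congʳ (*-congˡ (⟦⟧-⊗⊕⊗ m q′ q p′))) ⟨
    E · ⟦ m ⊗ p′ ⊕ q ⊗ q′ ⊗ Δ ⟧ + E · ⟦ m ⊗ q′ ⊕ q ⊗ p′ ⟧ · r
      ≈⟨ +-cong (⟦⟧-⊗ d (m ⊗ p′ ⊕ q ⊗ q′ ⊗ Δ)) (*-congʳ (⟦⟧-⊗ d (m ⊗ q′ ⊕ q ⊗ p′))) ⟨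
    ⟦ d ⊗ (m ⊗ p′ ⊕ q ⊗ q′ ⊗ Δ) ⟧ + ⟦ d ⊗ (m ⊗ q′ ⊕ q ⊗ p′) ⟧ · r  ∎)
    where
    m  = d ⊕ ⊖ p
    M  = ⟦ m ⟧
    P  = ⟦ p ⟧
    Q  = ⟦ q ⟧
    E  = ⟦ d ⟧
    P′ = ⟦ p′ ⟧
    Q′ = ⟦ q′ ⟧
    E′ = ⟦ d′ ⟧
    m≈ : M ≈ E + - P
    m≈ = ⟦⟧-− d p
    linear : E · f + - ((P + Q · r) · f) ≈ E · u
    linear = begin
      E · f + - ((P + Q · r) · f)              ≈⟨ +-cong (*-congˡ fix) (-‿cong (*-congʳ (≈-sym eq))) ⟩
      E · (u + v · f) + - (E · v · f)
        ≈⟨ solve four (λ d u v f → d :* (u :+ v :* f) :+ :- (d :* v :* f) := d :* u) ≈-refl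
             E u v f ⟩
      E · u                                    ∎

  ≋-θ : ∀ {f s} → f ≋ s → θ f ≋ θˢ Δ s
  ≋-θ {f} {p +[ q ]√/ d} (surd eq) = surd (begin
    ⟦ (2 ∷ []) ⊗ (Δ ⊗ (d ⊗ d)) ⟧ · θ f
      ≈⟨ *-congʳ (≈-trans (⟦⟧-⊗ (2 ∷ []) (Δ ⊗ (d ⊗ d))) (*-congˡ (≈-trans
           (⟦⟧-⊗ Δ (d ⊗ d)) (*-cong (≈-sym r²≈Δ) (⟦⟧-⊗ d d))))) ⟩
    ⟦ 2 ∷ [] ⟧ · (r · r · (E · E)) · θ f
      ≈⟨ solve five (λ d f dθ fθ r → con 2 :* (r :* r :* (d :* d)) :* fθ
             := con 2 :* (r :* r :* d) :* ((dθ :* f :+ d :* fθ) :+ :- (dθ :* f))) ≈-refl E f (θ E) (θ f) r ⟩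
    ⟦ 2 ∷ [] ⟧ · (r · r · E) · ((θ E · f + E · θ f) + - (θ E · f))
      ≈⟨ *-congˡ (+-congʳ differentiated) ⟩
    ⟦ 2 ∷ [] ⟧ · (r · r · E) · ((θ P + (θ Q · r + Q · θ r)) + - (θ E · f))
      ≈⟨ solve eight (λ d f dθ pθ q qθ r rθ →
             con 2 :* (r :* r :* d) :* ((pθ :+ (qθ :* r :+ q :* rθ)) :+ :- (dθ :* f))
             := con 2 :* (r :* r) :* (d :* (pθ :+ qθ :* r) :+ :- (dθ :* (d :* f)))
                  :+ d :* q :* (rθ :* r :+ r :* rθ) :* r) ≈-refl
             E f (θ E) (θ P) Q (θ Q) r (θ r) ⟩
    ⟦ 2 ∷ [] ⟧ · (r · r) · (E · (θ P + θ Q · r) + - (θ E · (E · f)))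
      + E · Q · (θ r · r + r · θ r) · r
      ≈⟨ +-cong (*-cong (*-congˡ r²≈Δ) (+-congˡ (-‿cong (*-congˡ eq)))) (*-congʳ (*-congˡ θr²)) ⟩
    ⟦ 2 ∷ [] ⟧ · ⟦ Δ ⟧ · (E · (θ P + θ Q · r) + - (θ E · (P + Q · r))) + E · Q · θ ⟦ Δ ⟧ · r
      ≈⟨ solve nine (λ δ δθ d dθ p pθ q qθ r →
            con 2 :* δ :* (d :* (pθ :+ qθ :* r) :+ :- (dθ :* (p :+ q :* r))) :+ d :* q :* δθ :* r
            := con 2 :* δ :* (d :* pθ :+ :- (dθ :* p))
                 :+ (con 2 :* δ :* (d :* qθ :+ :- (dθ :* q)) :+ d :* q :* δθ) :* r) ≈-refl
            ⟦ Δ ⟧ (θ ⟦ Δ ⟧) E (θ E) P (θ P) Q (θ Q) r ⟩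
    ⟦ 2 ∷ [] ⟧ · ⟦ Δ ⟧ · (E · θ P + - (θ E · P))
      + (⟦ 2 ∷ [] ⟧ · ⟦ Δ ⟧ · (E · θ Q + - (θ E · Q)) + E · Q · θ ⟦ Δ ⟧) · r
      ≈⟨ +-cong (quotient p) (*-congʳ (+-cong (quotient q) (*-cong (⟦⟧-⊗ d q) (⟦⟧-θ Δ)))) ⟨
    ⟦ (2 ∷ []) ⊗ Δ ⊗ (d ⊗ θₗ p ⊕ ⊖ (θₗ d ⊗ p)) ⟧
      + (⟦ (2 ∷ []) ⊗ Δ ⊗ (d ⊗ θₗ q ⊕ ⊖ (θₗ d ⊗ q)) ⟧ + ⟦ d ⊗ q ⟧ · ⟦ θₗ Δ ⟧) · r
      ≈⟨ +-congˡ (*-congʳ (≈-trans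
           (⟦⟧-⊕ ((2 ∷ []) ⊗ Δ ⊗ (d ⊗ θₗ q ⊕ ⊖ (θₗ d ⊗ q))) (d ⊗ q ⊗ θₗ Δ))
           (+-congˡ (⟦⟧-⊗ (d ⊗ q) (θₗ Δ))))) ⟨
    ⟦ (2 ∷ []) ⊗ Δ ⊗ (d ⊗ θₗ p ⊕ ⊖ (θₗ d ⊗ p)) ⟧
      + ⟦ (2 ∷ []) ⊗ Δ ⊗ (d ⊗ θₗ q ⊕ ⊖ (θₗ d ⊗ q)) ⊕ d ⊗ q ⊗ θₗ Δ ⟧ · r  ∎)
    where
    P = ⟦ p ⟧
    Q = ⟦ q ⟧
    E = ⟦ d ⟧
    θr² : θ r · r + r · θ r ≈ θ ⟦ Δ ⟧
    θr² = ≈-trans (≈-sym (θ-· r r)) (θ-cong r²≈Δ)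
    differentiated : θ E · f + E · θ f ≈ θ P + (θ Q · r + Q · θ r)
    differentiated = begin
      θ E · f + E · θ f               ≈⟨ θ-· E f ⟨
      θ (E · f)                       ≈⟨ θ-cong eq ⟩
      θ (P + Q · r)                   ≈⟨ θ-+ P (Q · r) ⟩
      θ P + θ (Q · r)                 ≈⟨ +-congˡ (θ-· Q r) ⟩
      θ P + (θ Q · r + Q · θ r)       ∎
    quotient : ∀ k → ⟦ (2 ∷ []) ⊗ Δ ⊗ (d ⊗ θₗ k ⊕ ⊖ (θₗ d ⊗ k)) ⟧
                     ≈ ⟦ 2 ∷ [] ⟧ · ⟦ Δ ⟧ · (E · θ ⟦ k ⟧ + - (θ E · ⟦ k ⟧))
    quotient k = ≈-trans (⟦⟧-⊗ ((2 ∷ []) ⊗ Δ) _) (*-cong (⟦⟧-⊗ (2 ∷ []) Δ) (≈-trans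
      (⟦⟧-⊗−⊗ d (θₗ k) (θₗ d) k)
      (+-cong (*-congˡ (⟦⟧-θ k)) (-‿cong (*-congʳ (⟦⟧-θ d))))))

  -- Fractions are compared by cross multiplication; for closed s and t the
  -- side conditions hold by evaluation.
  ≋-reduce : ∀ {f s} t → f ≋ s →
    {True (any? (λ i → ¬? (i ℤ.≟ 0ℤ)) (den s))} →
    {True (den s ⊗ rat t ≃? rat s ⊗ den t)} →
    {True (den s ⊗ irr t ≃? irr s ⊗ den t)} → f ≋ t
  ≋-reduce {f} {p +[ q ]√/ d} (p′ +[ q′ ]√/ d′) (surd eq) {nonzero} {rats} {irrs} =
    surd (⟦⟧-cancel (toWitness nonzero) _ _ (begin
      E · (E′ · f)
        ≈⟨ solve three (λ d d′ f → d :* (d′ :* f) := d :* f :* d′) ≈-refl E E′ f ⟩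
      E · f · E′
        ≈⟨ *-congʳ eq ⟩
      (⟦ p ⟧ + ⟦ q ⟧ · r) · E′
        ≈⟨ solve four (λ p q r d → (p :+ q :* r) :* d := p :* d :+ q :* d :* r) ≈-refl
             ⟦ p ⟧ ⟦ q ⟧ r E′ ⟩
      ⟦ p ⟧ · E′ + ⟦ q ⟧ · E′ · r
        ≈⟨ +-cong (cross p p′ {rats}) (*-congʳ (cross q q′ {irrs})) ⟨
      E · ⟦ p′ ⟧ + E · ⟦ q′ ⟧ · r
        ≈⟨ solve four (λ d p q r → d :* p :+ d :* q :* r := d :* (p :+ q :* r)) ≈-refl
             E ⟦ p′ ⟧ ⟦ q′ ⟧ r ⟩
      E · (⟦ p′ ⟧ + ⟦ q′ ⟧ · r) ∎))
    where
    E  = ⟦ d ⟧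
    E′ = ⟦ d′ ⟧
    cross : ∀ k l → {True (d ⊗ l ≃? k ⊗ d′)} → E · ⟦ l ⟧ ≈ ⟦ k ⟧ · E′
    cross k l {eq} = ≈-trans (≈-sym (⟦⟧-⊗ d l))
      (≈-trans (⟦⟧-≃ (d ⊗ l) (k ⊗ d′) {eq}) (⟦⟧-⊗ k d′))

  solve-root : ∀ {h k l} → ⟦ k ⟧ + - (⟦ l ⟧ · h) ≈ r → h ≋ k +[ -1 ∷ [] ]√/ l
  solve-root {h} {k} {l} eq = surd (begin
    ⟦ l ⟧ · h
      ≈⟨ solve two (λ a b → b := a :+ con -1 :* (a :- b)) ≈-refl ⟦ k ⟧ (⟦ l ⟧ · h) ⟩
    ⟦ k ⟧ + ⟦ -1 ∷ [] ⟧ · (⟦ k ⟧ + - (⟦ l ⟧ · h))       ≈⟨ +-congˡ (*-congˡ eq) ⟩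
    ⟦ k ⟧ + ⟦ -1 ∷ [] ⟧ · r                             ∎)

  -- Equivalently, (f - r) (f + r) = 0.
  conjugate : ∀ {f} → f · f ≈ ⟦ Δ ⟧ → f · (f + r) ≈ r · (f + r)
  conjugate {f} f²≈Δ = begin
    f · (f + r)      ≈⟨ distribˡ f f r ⟩
    f · f + f · r    ≈⟨ +-cong (≈-trans f²≈Δ (≈-sym r²≈Δ)) (*-comm f r) ⟩
    r · r + r · f    ≈⟨ +-comm (r · r) (r · f) ⟩
    r · f + r · r    ≈⟨ distribˡ r f r ⟨
    r · (f + r)      ∎

  private
    x one : Carrier
    x   = ⟦ 0 ∷ 1 ∷ [] ⟧
    one = ⟦ 1 ∷ [] ⟧

  -- In t the polynomials are (1 - x)^2 and 2 x (1 - x).  Multiply the equation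
  -- x h^2 - (1 - x) h + x k = 0 by 4 x (1 - x)^2 and complete the square, using
  -- (1 - x) k = 1.
  discriminant : ∀ k g h → k ≈ one + x · k → g ≈ one + h → h ≈ x · (k + g · h) →
    let t = ⟦ 1 ∷ -2 ∷ 1 ∷ [] ⟧ + - (⟦ 0 ∷ 2 ∷ -2 ∷ [] ⟧ · h) in
    t · t ≈ ⟦ 1 ∷ -4 ∷ 2 ∷ 0 ∷ 1 ∷ [] ⟧
  discriminant k g h k≈ g≈ h≈g = begin
    t · t
      ≈⟨ *-cong expand expand ⟩
    (n · n + - (⟦ 2 ∷ [] ⟧ · x · n · h)) · (n · n + - (⟦ 2 ∷ [] ⟧ · x · n · h))
      ≈⟨ *-cong on-n on-n ⟩
    (m · m + - (⟦ 2 ∷ [] ⟧ · x · m · h)) · (m · m + - (⟦ 2 ∷ [] ⟧ · x · m · h))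
      -- The last summand vanishes by the equations for h and k.
      ≈⟨ solve three (λ x k h → let m = con 1 :- x ; t = m :* m :- con 2 :* x :* m :* h in
           t :* t := (m :* m :* m :* m :- con 4 :* x :* x :* m)
             :- con 4 :* x :* m :* (m :* (h :- x :* (k :+ (con 1 :+ h) :* h))
                                      :- x :* ((con 1 :+ x :* k) :- k))) ≈-refl x k h ⟩
    (m · m · m · m + - (⟦ 4 ∷ [] ⟧ · x · x · m))
      + - (⟦ 4 ∷ [] ⟧ · x · m · (m · (h + - (x · (k + (one + h) · h))) + - (x · ((one + x · k) + - k))))
      ≈⟨ +-congˡ (-‿cong (*-congˡ (+-cong (*-congˡ (+-congˡ (-‿cong (≈-sym h≈))))
           (-‿cong (*-congˡ (+-congʳ (≈-sym k≈))))))) ⟩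
    (m · m · m · m + - (⟦ 4 ∷ [] ⟧ · x · x · m))
      + - (⟦ 4 ∷ [] ⟧ · x · m · (m · (h + - h) + - (x · (k + - k))))
      ≈⟨ solve four (λ x m k h → (m :* m :* m :* m :- con 4 :* x :* x :* m)
            :- con 4 :* x :* m :* (m :* (h :- h) :- x :* (k :- k))
            := (m :* m :* m :* m :- con 4 :* x :* x :* m)) ≈-refl x m k h ⟩
    m · m · m · m + - (⟦ 4 ∷ [] ⟧ · x · x · m)
      ≈⟨ +-cong (*-cong (*-cong (*-cong m≈n m≈n) m≈n) m≈n) (-‿cong (*-congˡ m≈n)) ⟩
    n · n · n · n + - (⟦ 4 ∷ [] ⟧ · x · x · n)
      ≈⟨ +-cong (≈-trans (⟦⟧-⊗ (l ⊗ l ⊗ l) l) (*-congʳ (≈-trans (⟦⟧-⊗ (l ⊗ l) l) (*-congʳ (⟦⟧-⊗ l l)))))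
           (-‿cong (≈-trans (⟦⟧-⊗ ((4 ∷ []) ⊗ x′ ⊗ x′) l) (*-congʳ (≈-trans
             (⟦⟧-⊗ ((4 ∷ []) ⊗ x′) x′) (*-congʳ (⟦⟧-⊗ (4 ∷ []) x′)))))) ⟨
    ⟦ l ⊗ l ⊗ l ⊗ l ⟧ + - ⟦ (4 ∷ []) ⊗ x′ ⊗ x′ ⊗ l ⟧
      ≈⟨ ⟦⟧-− (l ⊗ l ⊗ l ⊗ l) ((4 ∷ []) ⊗ x′ ⊗ x′ ⊗ l) ⟨
    ⟦ l ⊗ l ⊗ l ⊗ l ⊕ ⊖ ((4 ∷ []) ⊗ x′ ⊗ x′ ⊗ l) ⟧
      ≈⟨ ⟦⟧-≃ (l ⊗ l ⊗ l ⊗ l ⊕ ⊖ ((4 ∷ []) ⊗ x′ ⊗ x′ ⊗ l)) (1 ∷ -4 ∷ 2 ∷ 0 ∷ 1 ∷ []) ⟩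
    ⟦ 1 ∷ -4 ∷ 2 ∷ 0 ∷ 1 ∷ [] ⟧ ∎
    where
    h≈ : h ≈ x · (k + (one + h) · h)
    h≈ = ≈-trans h≈g (*-congˡ (+-congˡ (*-congʳ g≈)))
    l x′ : List ℤ
    l  = 1 ∷ -1 ∷ []
    x′ = 0 ∷ 1 ∷ []
    t = ⟦ 1 ∷ -2 ∷ 1 ∷ [] ⟧ + - (⟦ 0 ∷ 2 ∷ -2 ∷ [] ⟧ · h)
    n = ⟦ l ⟧
    m = one + - x
    m≈n : m ≈ n
    m≈n = ≈-sym (⟦⟧-− (1 ∷ []) x′)
    on-n : n · n + - (⟦ 2 ∷ [] ⟧ · x · n · h) ≈ m · m + - (⟦ 2 ∷ [] ⟧ · x · m · h)
    on-n = ≈-sym (+-cong (*-cong m≈n m≈n) (-‿cong (*-congʳ (*-congˡ m≈n))))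
    expand : ⟦ 1 ∷ -2 ∷ 1 ∷ [] ⟧ + - (⟦ 0 ∷ 2 ∷ -2 ∷ [] ⟧ · h) ≈ n · n + - (⟦ 2 ∷ [] ⟧ · x · n · h)
    expand = +-cong (≈-trans (⟦⟧-≃ (1 ∷ -2 ∷ 1 ∷ []) (l ⊗ l)) (⟦⟧-⊗ l l))
      (-‿cong (*-congʳ (≈-trans (⟦⟧-≃ (0 ∷ 2 ∷ -2 ∷ []) ((2 ∷ []) ⊗ x′ ⊗ l))
        (≈-trans (⟦⟧-⊗ ((2 ∷ []) ⊗ x′) l) (*-congʳ (⟦⟧-⊗ (2 ∷ []) x′))))))

  -- The equations for the generating functions, brought to the form f = u + v f.

  linear-e : ∀ f g e → f ≈ one + e → e ≈ x · (f + g · e) → e ≈ x + (x + x · g) · e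
  linear-e f g e f≈ e≈ = ≈-trans e≈ (≈-trans (*-congˡ (+-congʳ f≈))
    (solve three (λ x g e → x :* ((con 1 :+ e) :+ g :* e) := x :+ (x :+ x :* g) :* e) ≈-refl x g e))

  linear-p : ∀ z p → p ≈ x · (p + z) → p ≈ x · z + x · p
  linear-p z p p≈ = ≈-trans p≈ (≈-trans (*-congˡ (+-comm p z)) (distribˡ x z p))

  linear-w : ∀ u y g h w →
    w ≈ x · (u + ((w + y) · h + g · w)) → w ≈ x · (u + y · h) + (x · h + x · g) · w
  linear-w u y g h w w≈ = ≈-trans w≈
    (solve six (λ x u y g h w → x :* (u :+ ((w :+ y) :* h :+ g :* w))
       := x :* (u :+ y :* h) :+ (x :* h :+ x :* g) :* w) ≈-refl x u y g h w)

  linear-v : ∀ z w g e v →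
    v ≈ x · ((v + z) + (w · e + g · v)) → v ≈ x · (z + w · e) + (x + x · g) · v
  linear-v z w g e v v≈ = ≈-trans v≈
    (solve six (λ x z w g e v → x :* ((v :+ z) :+ (w :* e :+ g :* v))
       := x :* (z :+ w :* e) :+ (x :+ x :* g) :* v) ≈-refl x z w g e v)

-- The differential ring of formal power series over ℚ

open Sum (Ring.semiring ℚ.+-*-ring) using (sum; sum-cong-≗; ∑-distrib-+)
open ℚ-Solver.+-*-Solver using (solve; _:=_; _:+_; _:*_; _:-_; con)

fromℤ-/1 : ∀ i → i ℚ./ 1 ≡ fromℤ i
fromℤ-/1 i = ℚ.↥p/↧p≡p (fromℤ i)

fromℤ-+ : ∀ i j → fromℤ (i ℤ.+ j) ≡ fromℤ i ℚ.+ fromℤ j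
fromℤ-+ i j = trans (sym (fromℤ-/1 (i ℤ.+ j)))
  (sym (cong₂ (λ k l → (k ℤ.+ l) ℚ./ 1) (ℤ.*-identityʳ i) (ℤ.*-identityʳ j)))

fromℤ-* : ∀ i j → fromℤ (i ℤ.* j) ≡ fromℤ i ℚ.* fromℤ j
fromℤ-* i j = sym (fromℤ-/1 (i ℤ.* j))

fromℤ-neg : ∀ i → fromℤ (ℤ.- i) ≡ ℚ.- fromℤ i
fromℤ-neg (ℤ.+ zero) = refl
fromℤ-neg ℤ.+[1+ n ] = refl
fromℤ-neg ℤ.-[1+ n ] = refl

infixl 6 _+_
infix  8 -_

_+_ : Series → Series → Series
(f + g) n = f n ℚ.+ g n

-_ : Series → Series
(- f) n = ℚ.- f n

-- The ring laws are proved by recursion on the index of the coefficient, from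
-- (f * g) (suc n) = f 0 * g (suc n) + (tail f * g) n, which holds by definition.

*-cong : ∀ {f f′ g g′} → f ≗ f′ → g ≗ g′ → f * g ≗ f′ * g′
*-cong f≗f′ g≗g′ n = sum-cong-≗ {suc n} λ i →
  cong₂ ℚ._*_ (f≗f′ (toℕ i)) (g≗g′ (n ℕ.∸ toℕ i))

*-congˡ : ∀ f {g g′} → g ≗ g′ → f * g ≗ f * g′
*-congˡ f = *-cong {f} (λ _ → refl)

*-congʳ : ∀ {f f′} g → f ≗ f′ → f * g ≗ f′ * g
*-congʳ {f} g f≗f′ = *-cong {f} {g = g} f≗f′ (λ _ → refl)

*-comm : ∀ f g → f * g ≗ g * f
*-comm f g zero    = cong (ℚ._+ 0ℚ) (ℚ.*-comm (f 0) (g 0))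
*-comm f g (suc n) = begin
  f 0 ℚ.* g (suc n) ℚ.+ (tail f * g) n
    ≡⟨ cong₂ ℚ._+_ (ℚ.*-comm (f 0) (g (suc n))) (*-comm (tail f) g n) ⟩
  g (suc n) ℚ.* f 0 ℚ.+ (g * tail f) n
    ≡⟨ ℚ.+-comm (g (suc n) ℚ.* f 0) _ ⟩
  (g * tail f) n ℚ.+ g (suc n) ℚ.* f 0
    ≡⟨ *-suc g f n ⟨
  (g * f) (suc n) ∎
  where open ≡-Reasoning

*-distribʳ : ∀ f g h → (g + h) * f ≗ g * f + h * f
*-distribʳ f g h zero    = solve three
  (λ x y z → (y :+ z) :* x :+ con 0ℚ := (y :* x :+ con 0ℚ) :+ (z :* x :+ con 0ℚ)) refl
  (f 0) (g 0) (h 0)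
*-distribʳ f g h (suc n) = trans
  (cong ((g 0 ℚ.+ h 0) ℚ.* f (suc n) ℚ.+_) (*-distribʳ f (tail g) (tail h) n))
  (solve five (λ x y z u v → (y :+ z) :* x :+ (u :+ v) := (y :* x :+ u) :+ (z :* x :+ v)) refl
    (f (suc n)) (g 0) (h 0) ((tail g * f) n) ((tail h * f) n))

*-scaleˡ : ∀ q f g n → ((λ i → q ℚ.* f i) * g) n ≡ q ℚ.* (f * g) n
*-scaleˡ q f g zero    = solve three
  (λ q x y → q :* x :* y :+ con 0ℚ := q :* (x :* y :+ con 0ℚ)) refl q (f 0) (g 0)
*-scaleˡ q f g (suc n) = trans
  (cong (q ℚ.* f 0 ℚ.* g (suc n) ℚ.+_) (*-scaleˡ q (tail f) g n))
  (solve four (λ q x y z → q :* x :* y :+ q :* z := q :* (x :* y :+ z)) refl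
    q (f 0) (g (suc n)) ((tail f * g) n))

*-assoc : ∀ f g h → (f * g) * h ≗ f * (g * h)
*-assoc f g h zero    = solve three
  (λ x y z → (x :* y :+ con 0ℚ) :* z :+ con 0ℚ := x :* (y :* z :+ con 0ℚ) :+ con 0ℚ) refl
  (f 0) (g 0) (h 0)
*-assoc f g h (suc n) = begin
  fg₀ ℚ.* z ℚ.+ (((λ i → f 0 ℚ.* tail g i) + tail f * g) * h) n
    ≡⟨ cong (fg₀ ℚ.* z ℚ.+_) (*-distribʳ h (λ i → f 0 ℚ.* tail g i) (tail f * g) n) ⟩
  fg₀ ℚ.* z ℚ.+ (((λ i → f 0 ℚ.* tail g i) * h) n ℚ.+ ((tail f * g) * h) n)
    ≡⟨ cong₂ (λ u v → fg₀ ℚ.* z ℚ.+ (u ℚ.+ v)) (*-scaleˡ (f 0) (tail g) h n) (*-assoc (tail f) g h n) ⟩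
  fg₀ ℚ.* z ℚ.+ (f 0 ℚ.* (tail g * h) n ℚ.+ (tail f * (g * h)) n)
    ≡⟨ solve five
         (λ x y z u v → (x :* y :+ con 0ℚ) :* z :+ (x :* u :+ v) := x :* (y :* z :+ u) :+ v) refl
         (f 0) (g 0) z ((tail g * h) n) ((tail f * (g * h)) n) ⟩
  f 0 ℚ.* (g 0 ℚ.* z ℚ.+ (tail g * h) n) ℚ.+ (tail f * (g * h)) n ∎
  where
  open ≡-Reasoning
  z   = h (suc n)
  fg₀ = f 0 ℚ.* g 0 ℚ.+ 0ℚ

0# 1# X : Series
0# = poly []
1# = poly (1 ∷ [])
X  = poly (0 ∷ 1 ∷ [])

*-zeroˡ : ∀ f → 0# * f ≗ 0#
*-zeroˡ f zero    = trans (ℚ.+-identityʳ _) (ℚ.*-zeroˡ (f 0))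
*-zeroˡ f (suc n) = cong₂ ℚ._+_ (ℚ.*-zeroˡ (f (suc n))) (*-zeroˡ f n)

constant-* : ∀ i f n → (poly (i ∷ []) * f) n ≡ fromℤ i ℚ.* f n
constant-* i f zero    = ℚ.+-identityʳ _
constant-* i f (suc n) =
  trans (cong (fromℤ i ℚ.* f (suc n) ℚ.+_) (*-zeroˡ f n)) (ℚ.+-identityʳ _)

*-identityˡ : ∀ f → 1# * f ≗ f
*-identityˡ f n = trans (constant-* 1 f n) (ℚ.*-identityˡ (f n))

X-*-suc : ∀ f n → (X * f) (suc n) ≡ f n
X-*-suc f n = trans (cong₂ ℚ._+_ (ℚ.*-zeroˡ (f (suc n))) (*-identityˡ f n)) (ℚ.+-identityˡ (f n))

X-*-zero : ∀ f → (X * f) 0 ≡ 0ℚ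
X-*-zero f = trans (ℚ.+-identityʳ _) (ℚ.*-zeroˡ (f 0))

tail-≗ : ∀ f g → f 0 ≡ 0ℚ → tail f ≗ g → f ≗ X * g
tail-≗ f g f₀≡0 f′≗g zero    = trans f₀≡0 (sym (X-*-zero g))
tail-≗ f g f₀≡0 f′≗g (suc n) = trans (f′≗g n) (sym (X-*-suc g n))

seriesRing : CommutativeRing 0ℓ 0ℓ
seriesRing = record
  { Carrier = Series ; _≈_ = _≗_ ; _+_ = _+_ ; _*_ = _*_ ; -_ = -_ ; 0# = 0# ; 1# = 1#
  ; isCommutativeRing = record
    { isRing = record
      { +-isAbelianGroup = Pointwise.isAbelianGroup ℕ (Ring.+-isAbelianGroup ℚ.+-*-ring)
      ; *-cong     = λ {f} {f′} {g} {g′} → *-cong {f} {f′} {g} {g′}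
      ; *-assoc    = *-assoc
      ; *-identity = *-identityˡ , λ f n → trans (*-comm f 1# n) (*-identityˡ f n)
      ; distrib    = (λ f g h n → trans (*-comm f (g + h) n) (trans (*-distribʳ f g h n)
                       (cong₂ ℚ._+_ (*-comm g f n) (*-comm h f n))))
                   , *-distribʳ
      }
    ; *-comm = *-comm
    }
  }

poly-⊕ : ∀ k l → poly (k ⊕ l) ≗ poly k + poly l
poly-⊕ []      l       n       = sym (ℚ.+-identityˡ _)
poly-⊕ (i ∷ k) []      n       = sym (ℚ.+-identityʳ _)
poly-⊕ (i ∷ k) (j ∷ l) zero    = fromℤ-+ i j
poly-⊕ (i ∷ k) (j ∷ l) (suc n) = poly-⊕ k l n

poly-⊖ : ∀ k → poly (⊖ k) ≗ - poly k
poly-⊖ []      n       = refl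
poly-⊖ (i ∷ k) zero    = fromℤ-neg i
poly-⊖ (i ∷ k) (suc n) = poly-⊖ k n

poly-scale : ∀ i k n → poly (map (i ℤ.*_) k) n ≡ fromℤ i ℚ.* poly k n
poly-scale i []      n       = sym (ℚ.*-zeroʳ (fromℤ i))
poly-scale i (j ∷ k) zero    = fromℤ-* i j
poly-scale i (j ∷ k) (suc n) = poly-scale i k n

poly-⊗ : ∀ k l → poly (k ⊗ l) ≗ poly k * poly l
poly-⊗ []      l n       = sym (*-zeroˡ (poly l) n)
poly-⊗ (i ∷ k) l zero    = trans (poly-⊕ (map (i ℤ.*_) l) (0 ∷ k ⊗ l) zero)
  (cong (ℚ._+ 0ℚ) (poly-scale i l zero))
poly-⊗ (i ∷ k) l (suc n) = trans (poly-⊕ (map (i ℤ.*_) l) (0 ∷ k ⊗ l) (suc n))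
  (cong₂ ℚ._+_ (poly-scale i l (suc n)) (poly-⊗ k l n))

poly-zero : ∀ {k} → All (_≡ 0ℤ) k → poly k ≗ 0#
poly-zero []          n       = refl
poly-zero (refl ∷ zs) zero    = refl
poly-zero (_    ∷ zs) (suc n) = poly-zero zs n

-- The derivation x d/dx.
θ : Series → Series
θ f n = fromℤ (ℤ.+ n) ℚ.* f n

θ-cong : ∀ {f g} → f ≗ g → θ f ≗ θ g
θ-cong f≗g n = cong (fromℤ (ℤ.+ n) ℚ.*_) (f≗g n)

θ-+ : ∀ f g → θ (f + g) ≗ θ f + θ g
θ-+ f g n = ℚ.*-distribˡ-+ (fromℤ (ℤ.+ n)) (f n) (g n)

fromℤ-suc-* : ∀ n q → fromℤ (ℤ.+ suc n) ℚ.* q ≡ q ℚ.+ fromℤ (ℤ.+ n) ℚ.* q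
fromℤ-suc-* n q = begin
  fromℤ (1ℤ ℤ.+ ℤ.+ n) ℚ.* q            ≡⟨ cong (ℚ._* q) (fromℤ-+ 1ℤ (ℤ.+ n)) ⟩
  (1ℚ ℚ.+ fromℤ (ℤ.+ n)) ℚ.* q          ≡⟨ ℚ.*-distribʳ-+ q 1ℚ (fromℤ (ℤ.+ n)) ⟩
  1ℚ ℚ.* q ℚ.+ fromℤ (ℤ.+ n) ℚ.* q      ≡⟨ cong (ℚ._+ fromℤ (ℤ.+ n) ℚ.* q) (ℚ.*-identityˡ q) ⟩
  q ℚ.+ fromℤ (ℤ.+ n) ℚ.* q             ∎
  where open ≡-Reasoning

θ-tail : ∀ f → tail (θ f) ≗ tail f + θ (tail f)
θ-tail f n = fromℤ-suc-* n (f (suc n))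

θ-* : ∀ f g → θ (f * g) ≗ θ f * g + f * θ g
θ-* f g zero    = solve two (λ x y → con 0ℚ :* (x :* y :+ con 0ℚ)
  := (con 0ℚ :* x :* y :+ con 0ℚ) :+ (x :* (con 0ℚ :* y) :+ con 0ℚ)) refl (f 0) (g 0)
θ-* f g (suc n) = begin
  N ℚ.* (f 0 ℚ.* g (suc n) ℚ.+ w)
    ≡⟨ ℚ.*-distribˡ-+ N (f 0 ℚ.* g (suc n)) w ⟩
  N ℚ.* (f 0 ℚ.* g (suc n)) ℚ.+ N ℚ.* w
    ≡⟨ cong (N ℚ.* (f 0 ℚ.* g (suc n)) ℚ.+_)
         (trans (fromℤ-suc-* n w) (cong (w ℚ.+_) (θ-* (tail f) g n))) ⟩
  N ℚ.* (f 0 ℚ.* g (suc n)) ℚ.+ (w ℚ.+ (u ℚ.+ v))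
    ≡⟨ solve six (λ x y m u v w → m :* (x :* y) :+ (w :+ (u :+ v))
         := (con 0ℚ :* x :* y :+ (w :+ u)) :+ (x :* (m :* y) :+ v)) refl
         (f 0) (g (suc n)) N u v w ⟩
  (0ℚ ℚ.* f 0 ℚ.* g (suc n) ℚ.+ (w ℚ.+ u)) ℚ.+ (f 0 ℚ.* θ g (suc n) ℚ.+ v)
    ≡⟨ cong (λ q → (0ℚ ℚ.* f 0 ℚ.* g (suc n) ℚ.+ q) ℚ.+ (f 0 ℚ.* θ g (suc n) ℚ.+ v))
         (trans (*-congʳ {tail (θ f)} g (θ-tail f) n) (*-distribʳ g (tail f) (θ (tail f)) n)) ⟨
  (0ℚ ℚ.* f 0 ℚ.* g (suc n) ℚ.+ (tail (θ f) * g) n) ℚ.+ (f 0 ℚ.* θ g (suc n) ℚ.+ v) ∎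
  where
  open ≡-Reasoning
  N = fromℤ (ℤ.+ suc n)
  u = (θ (tail f) * g) n
  v = (tail f * θ g) n
  w = (tail f * g) n

poly-θ : ∀ k → poly (θₗ k) ≗ θ (poly k)
poly-θ []      n       = sym (ℚ.*-zeroʳ (fromℤ (ℤ.+ n)))
poly-θ (i ∷ k) zero    = sym (ℚ.*-zeroˡ (fromℤ i))
poly-θ (i ∷ k) (suc n) = trans (poly-⊕ k (θₗ k) n)
  (trans (cong (poly k n ℚ.+_) (poly-θ k n)) (sym (θ-tail (poly (i ∷ k)) n)))

÷-unique : ∀ f g h .{{_ : ℚ.NonZero (g 0)}} → f * g ≗ h → f ≗ h ÷ g
÷-unique f g h fg≗h zero    = begin
  f 0                          ≡⟨ ℚ.*-identityʳ (f 0) ⟨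
  f 0 ℚ.* 1ℚ                   ≡⟨ cong (f 0 ℚ.*_) (ℚ.*-inverseʳ (g 0)) ⟨
  f 0 ℚ.* (g 0 ℚ.* ℚ.1/ g 0)   ≡⟨ ℚ.*-assoc (f 0) (g 0) _ ⟨
  f 0 ℚ.* g 0 ℚ.* ℚ.1/ g 0
    ≡⟨ cong (ℚ._* ℚ.1/ g 0) (trans (sym (ℚ.+-identityʳ (f 0 ℚ.* g 0))) (fg≗h 0)) ⟩
  h 0 ℚ.÷ g 0                  ∎
  where open ≡-Reasoning
÷-unique f g h fg≗h (suc n) = ÷-unique (tail f) g (remainder h g) tails n
  where
  open ≡-Reasoning
  tails : tail f * g ≗ remainder h g
  tails m = begin
    w                   ≡⟨ solve two (λ u w → w := (u :+ w) :- u) refl u w ⟩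
    u ℚ.+ w ℚ.- u
      ≡⟨ cong₂ (λ q r → q ℚ.- r ℚ.* g (suc m)) (fg≗h (suc m)) (÷-unique f g h fg≗h 0) ⟩
    remainder h g m     ∎
    where
    u = f 0 ℚ.* g (suc m)
    w = (tail f * g) m

*-cancelʳ : ∀ f f′ g .{{_ : ℚ.NonZero (g 0)}} → f * g ≗ f′ * g → f ≗ f′
*-cancelʳ f f′ g eq n =
  trans (÷-unique f g (f′ * g) eq n) (sym (÷-unique f′ g (f′ * g) (λ _ → refl) n))

-- Powers of x are cancelled first, then a polynomial with nonzero constant term.
poly-cancel : ∀ {k} → Any (_≢ 0ℤ) k → ∀ f g → poly k * f ≗ poly k * g → f ≗ g
poly-cancel {i ∷ k} nonzero f g eq with i ℤ.≟ 0ℤ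
... | no i≢0 =
  *-cancelʳ f g (poly (i ∷ k)) {{ℚ.≢-nonZero {fromℤ i} (i≢0 ∘ cong ℚ.numerator)}} λ n →
    trans (*-comm f (poly (i ∷ k)) n) (trans (eq n) (*-comm (poly (i ∷ k)) g n))
poly-cancel {i ∷ k} (here i≢0)      f g eq | yes i≡0  = contradiction i≡0 i≢0
poly-cancel {i ∷ k} (there nonzero) f g eq | yes refl = poly-cancel nonzero f g λ n → begin
  (poly k * f) n              ≡⟨ drop f n ⟨
  (poly (0 ∷ k) * f) (suc n)  ≡⟨ eq (suc n) ⟩
  (poly (0 ∷ k) * g) (suc n)  ≡⟨ drop g n ⟩
  (poly k * g) n              ∎
  where
  open ≡-Reasoning
  drop : ∀ h n → (poly (0 ∷ k) * h) (suc n) ≡ (poly k * h) n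
  drop h n = trans (cong (ℚ._+ (poly k * h) n) (ℚ.*-zeroˡ (h (suc n)))) (ℚ.+-identityˡ _)

-- The solution of the system for the generating functions

-- The radicand 1 - 4 x + 2 x^2 + x^4.
Δ : List ℤ
Δ = 1 ∷ -4 ∷ 2 ∷ 0 ∷ 1 ∷ []

surdRing : SurdRing Δ
surdRing = record
  { ring = seriesRing ; ⟦_⟧ = poly ; ⟦⟧-⊕ = poly-⊕ ; ⟦⟧-⊖ = poly-⊖ ; ⟦⟧-⊗ = poly-⊗
  ; ⟦⟧-1 = λ _ → refl ; ⟦⟧-0 = poly-zero ; ⟦⟧-cancel = poly-cancel
  ; θ = θ ; θ-cong = λ {f} {g} → θ-cong {f} {g} ; θ-+ = θ-+ ; θ-· = θ-* ; ⟦⟧-θ = poly-θ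
  ; r = √ poly Δ ; r²≈Δ = √-square (poly Δ) refl
  }

open Surds surdRing

-- The factor f + √Δ has constant term 2, so it can be cancelled.
√-unique : ∀ f → f 0 ≡ 1ℚ → f * f ≗ poly Δ → f ≗ √ poly Δ
√-unique f f₀≡1 f²≗Δ =
  *-cancelʳ f (√ poly Δ) (f + √ poly Δ) {{ℚ.≢-nonZero f₀+1≢0}} (conjugate {f} f²≗Δ)
  where
  f₀+1≢0 : f 0 ℚ.+ 1ℚ ≢ 0ℚ
  f₀+1≢0 eq with () ← trans (cong (ℚ._+ 1ℚ) (sym f₀≡1)) eq

-- If f counts the Dyck paths of a family by semi-length, then `points f` adds up
-- their numbers of lattice points: a path of semi-length n has 2n + 1 of them.
points : Series → Series
points f = poly (2 ∷ []) * θ f + f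

-- If moreover v adds up the areas, then `raised v f` adds up the areas after
-- each path is raised by one.
raised : (v f : Series) → Series
raised v f = v + points f

≋-points : ∀ {f s} → f ≋ s →
  points f ≋ mulˢ Δ ((2 ∷ []) +[ [] ]√/ (1 ∷ [])) (θˢ Δ s) +ˢ s
≋-points f≋ = ≋-+ (≋-· (≋-⟦⟧ (2 ∷ [])) (≋-θ f≋)) f≋

-- The coefficients of c.
cₗ : List ℤ
cₗ = 0 ∷ 1 ∷ -10 ∷ 41 ∷ -89 ∷ 108 ∷ -73 ∷ 18 ∷ 2 ∷ []

-- The fraction claimed for the area series: its denominator is
-- (1 - x)^2 (1 - 4 x + 2 x^2)^3 (1 - 3 x - x^2 - x^3), multiplied out.
areaSurd : Surd
areaSurd =
  (0 ∷ 2 ∷ -23 ∷ 107 ∷ -262 ∷ 359 ∷ -256 ∷ 82 ∷ -5 ∷ -10 ∷ 6 ∷ [])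
    +[ ⊖ cₗ ]√/
  (1 ∷ -17 ∷ 120 ∷ -456 ∷ 1017 ∷ -1381 ∷ 1186 ∷ -710 ∷ 364 ∷ -172 ∷ 56 ∷ -8 ∷ [])

-- The unknowns are determined one after the other; each `≋-reduce` cancels
-- common factors from the fraction computed for its unknown.
area-closed-form : ∀ k p g h w f e v →
  k ≗ 1# + X * k →
  p ≗ X * raised p k →
  g ≗ 1# + h →
  h ≗ X * (k + g * h) →
  w ≗ X * (raised p k + (raised w g * h + g * w)) →
  f ≗ 1# + e →
  e ≗ X * (f + g * e) →
  v ≗ X * (raised v f + (raised w g * e + g * v)) →
  v ≋ areaSurd
area-closed-form k p g h w f e v k≗ p≗ g≗ h≗ w≗ f≗ e≗ v≗ =
  ≋-reduce areaSurd (≋-fix (≋-· X≋ (≋-+ (≋-points f≋) (≋-· raised-w≋ e≋))) (≋-+ X≋ (≋-· X≋ g≋))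
    (linear-v (points f) (raised w g) g e v v≗))
  where
  t : Series
  t = poly (1 ∷ -2 ∷ 1 ∷ []) + - (poly (0 ∷ 2 ∷ -2 ∷ []) * h)

  t≗√Δ : t ≗ √ poly Δ
  t≗√Δ = √-unique t (cong (λ q → 1ℚ ℚ.+ ℚ.- (q ℚ.+ 0ℚ)) (ℚ.*-zeroˡ (h 0)))
    (discriminant k g h k≗ g≗ h≗)

  X≋ = ≋-⟦⟧ (0 ∷ 1 ∷ [])
  1≋ = ≋-⟦⟧ (1 ∷ [])

  k≋ : k ≋ (1 ∷ []) +[ [] ]√/ (1 ∷ -1 ∷ [])
  k≋ = ≋-reduce _ (≋-fix 1≋ X≋ k≗)

  p≋ : p ≋ (0 ∷ 1 ∷ 1 ∷ []) +[ [] ]√/ (1 ∷ -3 ∷ 3 ∷ -1 ∷ [])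
  p≋ = ≋-reduce _ (≋-fix (≋-· X≋ (≋-points k≋)) X≋ (linear-p (points k) p p≗))

  h≋ : h ≋ (1 ∷ -2 ∷ 1 ∷ []) +[ -1 ∷ [] ]√/ (0 ∷ 2 ∷ -2 ∷ [])
  h≋ = solve-root t≗√Δ

  g≋ : g ≋ (1 ∷ 0 ∷ -1 ∷ []) +[ -1 ∷ [] ]√/ (0 ∷ 2 ∷ -2 ∷ [])
  g≋ = ≋-resp (sym ∘ g≗) (≋-reduce _ (≋-+ 1≋ h≋))

  points-g≋ : points g ≋
    (-1 ∷ 6 ∷ -11 ∷ 8 ∷ -3 ∷ 2 ∷ -1 ∷ []) +[ 1 ∷ -2 ∷ 4 ∷ 2 ∷ -1 ∷ [] ]√/
    (0 ∷ 2 ∷ -10 ∷ 12 ∷ -4 ∷ 2 ∷ -2 ∷ [])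
  points-g≋ = ≋-reduce _ (≋-points g≋)

  w≋ : w ≋
    (1 ∷ -6 ∷ 15 ∷ -18 ∷ 9 ∷ 0 ∷ -1 ∷ []) +[ -1 ∷ 4 ∷ -6 ∷ 8 ∷ -1 ∷ [] ]√/
    (0 ∷ 2 ∷ -12 ∷ 22 ∷ -16 ∷ 6 ∷ -4 ∷ 2 ∷ [])
  w≋ = ≋-reduce _ (≋-fix
    (≋-· X≋ (≋-+ (≋-+ p≋ (≋-points k≋)) (≋-· points-g≋ h≋))) (≋-+ (≋-· X≋ h≋) (≋-· X≋ g≋))
    (linear-w (raised p k) (points g) g h w w≗))

  raised-w≋ : raised w g ≋
    (1 ∷ -2 ∷ 1 ∷ -2 ∷ 5 ∷ -4 ∷ 1 ∷ []) +[ 1 ∷ 0 ∷ 6 ∷ -4 ∷ 1 ∷ [] ]√/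
    (2 ∷ -12 ∷ 22 ∷ -16 ∷ 6 ∷ -4 ∷ 2 ∷ [])
  raised-w≋ = ≋-reduce _ (≋-+ w≋ points-g≋)

  e≋ : e ≋ (-1 ∷ 4 ∷ -3 ∷ []) +[ 1 ∷ [] ]√/ (2 ∷ -8 ∷ 4 ∷ [])
  e≋ = ≋-reduce _ (≋-fix X≋ (≋-+ X≋ (≋-· X≋ g≋)) (linear-e f g e f≗ e≗))

  f≋ : f ≋ (1 ∷ -4 ∷ 1 ∷ []) +[ 1 ∷ [] ]√/ (2 ∷ -8 ∷ 4 ∷ [])
  f≋ = ≋-resp (sym ∘ f≗) (≋-reduce _ (≋-+ 1≋ e≋))

-- Dyck paths and their first return decomposition

open CommutativeSemigroup ℤ.+-commutativeSemigroup using (interchange)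

variable
  p q A B A′ B′ : Path

-- The path whose first return decomposition, for Dyck paths A and B, is (A , B).
node : Path → Path → Path
node A B = U ∷ A ++ D ∷ B

-- Dyck paths, generated by the first return decomposition; see `dyck⇒isDyck` and
-- `isDyck⇒dyck`.
data Dyck : Path → Set where
  empty  : Dyck []
  return : Dyck A → Dyck B → Dyck (node A B)

up-down : ∀ y → y ▹ U ▹ D ≡ y
up-down y = trans (ℤ.+-assoc y 1ℤ -1ℤ) (ℤ.+-identityʳ y)

dyck-end : Dyck A → ∀ y → foldl _▹_ y A ≡ y
dyck-end empty y = refl
dyck-end (return {A} {B} α β) y = begin
  foldl _▹_ (y ▹ U) (A ++ D ∷ B)          ≡⟨ List.foldl-++ _▹_ (y ▹ U) A (D ∷ B) ⟩
  foldl _▹_ (foldl _▹_ (y ▹ U) A ▹ D) B   ≡⟨ cong (λ z → foldl _▹_ (z ▹ D) B) (dyck-end α (y ▹ U)) ⟩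
  foldl _▹_ (y ▹ U ▹ D) B                 ≡⟨ dyck-end β (y ▹ U ▹ D) ⟩
  y ▹ U ▹ D                               ≡⟨ up-down y ⟩
  y                                       ∎
  where open ≡-Reasoning

ordinates-++ : ∀ y p s q →
  ordinates y (p ++ s ∷ q) ≡ ordinates y p ++ ordinates (foldl _▹_ y p ▹ s) q
ordinates-++ y []      s q = refl
ordinates-++ y (t ∷ p) s q = cong (y ∷_) (ordinates-++ (y ▹ t) p s q)

ordinates-node : Dyck A → ∀ y B → ordinates y (node A B) ≡ y ∷ ordinates (y ▹ U) A ++ ordinates y B
ordinates-node {A} α y B = cong (y ∷_) (trans (ordinates-++ (y ▹ U) A D B)
  (cong (λ z → ordinates (y ▹ U) A ++ ordinates z B)
    (trans (cong (_▹ D) (dyck-end α (y ▹ U))) (up-down y))))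

▹-shift : ∀ y s → (y ℤ.+ 1ℤ) ▹ s ≡ (y ▹ s) ℤ.+ 1ℤ
▹-shift y U = refl
▹-shift y D = trans (up-down y) (sym (trans (ℤ.+-assoc y -1ℤ 1ℤ) (ℤ.+-identityʳ y)))

ordinates-shift : ∀ y p → ordinates (y ℤ.+ 1ℤ) p ≡ map (ℤ._+ 1ℤ) (ordinates y p)
ordinates-shift y []      = refl
ordinates-shift y (s ∷ p) = cong (y ℤ.+ 1ℤ ∷_)
  (trans (cong (λ z → ordinates z p) (▹-shift y s)) (ordinates-shift (y ▹ s) p))

dyck-nonneg : Dyck A → ∀ {y} → 0ℤ ℤ.≤ y → All (0ℤ ℤ.≤_) (ordinates y A)
dyck-nonneg empty 0≤y = 0≤y ∷ []
dyck-nonneg (return {A} {B} α β) {y} 0≤y = subst (All (0ℤ ℤ.≤_)) (sym (ordinates-node α y B))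
  (0≤y ∷ All.++⁺ (dyck-nonneg α (ℤ.≤-trans 0≤y (ℤ.i≤i+j y 1))) (dyck-nonneg β 0≤y))

dyck⇒isDyck : Dyck p → IsDyck p
dyck⇒isDyck δ = dyck-nonneg δ ℤ.≤-refl , dyck-end δ 0ℤ

-- Paths from height k to height 0 that stay nonnegative, decomposed into k + 1
-- Dyck paths separated by the down steps that first reach a new minimum.
data Forest : ℕ → Path → Set where
  tree : Dyck p → Forest 0 p
  _∷_  : ∀ {k} → Dyck A → Forest k p → Forest (suc k) (A ++ D ∷ p)

graft : ∀ {k} → Forest (suc k) p → Forest k (U ∷ p)
graft (α ∷ tree β) = tree (return α β)
graft (_∷_ {A} α (_∷_ {B} {q} β φ)) =
  subst (Forest _) (cong (U ∷_) (List.++-assoc A (D ∷ B) (D ∷ q))) (return α β ∷ φ)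

forest : ∀ k p → All (0ℤ ℤ.≤_) (ordinates (ℤ.+ k) p) → foldl _▹_ (ℤ.+ k) p ≡ 0ℤ → Forest k p
forest zero    []          _            _   = tree empty
forest k       (U ∷ p)     (_ ∷ ≥0)     end = graft (forest (suc k) p
  (subst (λ j → All (0ℤ ℤ.≤_) (ordinates (ℤ.+ j) p)) (ℕ.+-comm k 1) ≥0)
  (subst (λ j → foldl _▹_ (ℤ.+ j) p ≡ 0ℤ) (ℕ.+-comm k 1) end))
forest zero    (D ∷ [])    (_ ∷ () ∷ _) _
forest zero    (D ∷ _ ∷ _) (_ ∷ () ∷ _) _
forest (suc k) (D ∷ p)     (_ ∷ ≥0)     end = empty ∷ forest k p ≥0 end

isDyck⇒dyck : IsDyck p → Dyck p
isDyck⇒dyck {p} (≥0 , end) with forest 0 p ≥0 end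
... | tree δ = δ

-- Splits a path at its first down step that ends at height - (k + 1), relative to
-- the starting point, and removes that step; without such a step the second part
-- is empty.
cut : ℕ → Path → Path × Path
cut k       []      = [] , []
cut k       (U ∷ p) = map₁ (U ∷_) (cut (suc k) p)
cut zero    (D ∷ p) = [] , p
cut (suc k) (D ∷ p) = map₁ (D ∷_) (cut k p)

cut-dyck : Dyck A → ∀ k q → cut k (A ++ q) ≡ map₁ (A ++_) (cut k q)
cut-dyck empty k q = refl
cut-dyck (return {A} {B} α β) k q = cong (map₁ (U ∷_)) (begin
  cut (suc k) ((A ++ D ∷ B) ++ q)
    ≡⟨ cong (cut (suc k)) (List.++-assoc A (D ∷ B) q) ⟩
  cut (suc k) (A ++ D ∷ B ++ q)
    ≡⟨ cut-dyck α (suc k) (D ∷ B ++ q) ⟩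
  map₁ (A ++_) (map₁ (D ∷_) (cut k (B ++ q)))
    ≡⟨ cong (map₁ (A ++_) ∘ map₁ (D ∷_)) (cut-dyck β k q) ⟩
  map₁ (λ p → A ++ D ∷ B ++ p) (cut k q)
    ≡⟨ cong (_, proj₂ (cut k q)) (List.++-assoc A (D ∷ B) (proj₁ (cut k q))) ⟨
  map₁ ((A ++ D ∷ B) ++_) (cut k q) ∎)
  where open ≡-Reasoning

node-injective : Dyck A → Dyck A′ → node A B ≡ node A′ B′ → (A , B) ≡ (A′ , B′)
node-injective {A} {A′} {B} {B′} α α′ eq = begin
  A , B                     ≡⟨ cong (_, B) (List.++-identityʳ A) ⟨
  A ++ [] , B               ≡⟨ cut-dyck α 0 (D ∷ B) ⟨
  cut 0 (A ++ D ∷ B)        ≡⟨ cong (cut 0) (List.∷-injectiveʳ eq) ⟩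
  cut 0 (A′ ++ D ∷ B′)      ≡⟨ cut-dyck α′ 0 (D ∷ B′) ⟩
  A′ ++ [] , B′             ≡⟨ cong (_, B′) (List.++-identityʳ A′) ⟩
  A′ , B′                   ∎
  where open ≡-Reasoning

semilength-++ : ∀ p q → semilength (p ++ q) ≡ semilength p ℕ.+ semilength q
semilength-++ []      q = refl
semilength-++ (U ∷ p) q = cong suc (semilength-++ p q)
semilength-++ (D ∷ p) q = semilength-++ p q

sumℤ : List ℤ → ℤ
sumℤ = foldr ℤ._+_ 0ℤ

sumℤ-++ : ∀ k l → sumℤ (k ++ l) ≡ sumℤ k ℤ.+ sumℤ l
sumℤ-++ []      l = sym (ℤ.+-identityˡ _)
sumℤ-++ (i ∷ k) l = trans (cong (ℤ._+_ i) (sumℤ-++ k l)) (sym (ℤ.+-assoc i (sumℤ k) (sumℤ l)))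

sumℤ-shift : ∀ k → sumℤ (map (ℤ._+ 1ℤ) k) ≡ sumℤ k ℤ.+ ℤ.+ length k
sumℤ-shift []      = refl
sumℤ-shift (i ∷ k) = begin
  i ℤ.+ 1ℤ ℤ.+ sumℤ (map (ℤ._+ 1ℤ) k)           ≡⟨ cong (ℤ._+_ (i ℤ.+ 1ℤ)) (sumℤ-shift k) ⟩
  i ℤ.+ 1ℤ ℤ.+ (sumℤ k ℤ.+ ℤ.+ length k)        ≡⟨ interchange i 1ℤ (sumℤ k) (ℤ.+ length k) ⟩
  i ℤ.+ sumℤ k ℤ.+ ℤ.+ length (i ∷ k)           ∎
  where open ≡-Reasoning

length-ordinates : ∀ y p → length (ordinates y p) ≡ suc (length p)
length-ordinates y []      = refl
length-ordinates y (s ∷ p) = cong suc (length-ordinates (y ▹ s) p)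

-- Raising A by one adds one for each of its lattice points.
area-node : Dyck A → ∀ B →
  area (node A B) ≡ area A ℤ.+ ℤ.+ suc (2 ℕ.* semilength A) ℤ.+ area B
area-node {A} α B = begin
  area (node A B)                                       ≡⟨ cong sumℤ (ordinates-node α 0ℤ B) ⟩
  0ℤ ℤ.+ sumℤ (ordinates 1ℤ A ++ ordinates 0ℤ B)        ≡⟨ ℤ.+-identityˡ _ ⟩
  sumℤ (ordinates 1ℤ A ++ ordinates 0ℤ B)               ≡⟨ sumℤ-++ (ordinates 1ℤ A) (ordinates 0ℤ B) ⟩
  sumℤ (ordinates 1ℤ A) ℤ.+ area B                      ≡⟨ cong (λ l → sumℤ l ℤ.+ area B) (ordinates-shift 0ℤ A) ⟩
  sumℤ (map (ℤ._+ 1ℤ) (ordinates 0ℤ A)) ℤ.+ area B      ≡⟨ cong (ℤ._+ area B) (sumℤ-shift (ordinates 0ℤ A)) ⟩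
  area A ℤ.+ ℤ.+ length (ordinates 0ℤ A) ℤ.+ area B
    ≡⟨ cong (λ m → area A ℤ.+ ℤ.+ m ℤ.+ area B)
         (trans (length-ordinates 0ℤ A) (cong suc (dyck-length {A} (dyck⇒isDyck α)))) ⟩
  area A ℤ.+ ℤ.+ suc (2 ℕ.* semilength A) ℤ.+ area B    ∎
  where open ≡-Reasoning

-- Valley levels

valleyLevels-∷ʳD : ∀ y p → valleyLevels y (p ++ D ∷ []) ≡ valleyLevels y p
valleyLevels-∷ʳD y []          = refl
valleyLevels-∷ʳD y (U ∷ p)     = valleyLevels-∷ʳD (y ▹ U) p
valleyLevels-∷ʳD y (D ∷ [])    = refl
valleyLevels-∷ʳD y (D ∷ U ∷ p) = cong (y ▹ D ∷_) (valleyLevels-∷ʳD (y ▹ D) (U ∷ p))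
valleyLevels-∷ʳD y (D ∷ D ∷ p) = valleyLevels-∷ʳD (y ▹ D) (D ∷ p)

valleyLevels-++DU : ∀ y p q → let z = foldl _▹_ y p ▹ D in
  valleyLevels y (p ++ D ∷ U ∷ q) ≡ valleyLevels y p ++ z ∷ valleyLevels z (U ∷ q)
valleyLevels-++DU y []          q = refl
valleyLevels-++DU y (U ∷ p)     q = valleyLevels-++DU (y ▹ U) p q
valleyLevels-++DU y (D ∷ [])    q = refl
valleyLevels-++DU y (D ∷ U ∷ p) q = cong (y ▹ D ∷_) (valleyLevels-++DU (y ▹ D) (U ∷ p) q)
valleyLevels-++DU y (D ∷ D ∷ p) q = valleyLevels-++DU (y ▹ D) (D ∷ p) q

valleyLevels-shift : ∀ y p → valleyLevels (y ℤ.+ 1ℤ) p ≡ map (ℤ._+ 1ℤ) (valleyLevels y p)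
valleyLevels-shift y []          = refl
valleyLevels-shift y (U ∷ p)     = valleyLevels-shift (y ▹ U) p
valleyLevels-shift y (D ∷ [])    = refl
valleyLevels-shift y (D ∷ U ∷ p) = trans
  (cong (λ z → z ∷ valleyLevels z (U ∷ p)) (▹-shift y D))
  (cong (y ▹ D ℤ.+ 1ℤ ∷_) (valleyLevels-shift (y ▹ D) (U ∷ p)))
valleyLevels-shift y (D ∷ D ∷ p) = trans
  (cong (λ z → valleyLevels z (D ∷ p)) (▹-shift y D)) (valleyLevels-shift (y ▹ D) (D ∷ p))

valleyLevels-all : ∀ {P : ℤ → Set} y p → All P (ordinates y p) → All P (valleyLevels y p)
valleyLevels-all y []          _              = []
valleyLevels-all y (U ∷ p)     (_ ∷ zs)       = valleyLevels-all (y ▹ U) p zs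
valleyLevels-all y (D ∷ [])    _              = []
valleyLevels-all y (D ∷ U ∷ p) (_ ∷ pz ∷ zs)  = pz ∷ valleyLevels-all (y ▹ D) (U ∷ p) (pz ∷ zs)
valleyLevels-all y (D ∷ D ∷ p) (_ ∷ zs)       = valleyLevels-all (y ▹ D) (D ∷ p) zs

levels : Path → List ℤ
levels = valleyLevels 0ℤ

levels-nonneg : Dyck p → All (0ℤ ℤ.≤_) (levels p)
levels-nonneg {p} δ = valleyLevels-all 0ℤ p (dyck-nonneg δ ℤ.≤-refl)

levels-hill : ∀ A → levels (node A []) ≡ map (ℤ._+ 1ℤ) (levels A)
levels-hill A = trans (valleyLevels-∷ʳD 1ℤ A) (valleyLevels-shift 0ℤ A)

levels-node : Dyck A → ∀ q →
  levels (node A (U ∷ q)) ≡ map (ℤ._+ 1ℤ) (levels A) ++ 0ℤ ∷ levels (U ∷ q)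
levels-node {A} α q = trans (valleyLevels-++DU 1ℤ A q)
  (cong₂ (λ l z → l ++ z ∷ valleyLevels z (U ∷ q))
    (valleyLevels-shift 0ℤ A) (cong (_▹ D) (dyck-end α 1ℤ)))

infix 4 _↘_

-- The condition on consecutive valley levels.
_↘_ : ℤ → ℤ → Set
ν ↘ ν′ = -1ℤ ℤ.≤ ν′ ℤ.- ν

↘-shift : ∀ ν ν′ → (ν′ ℤ.+ 1ℤ) ℤ.- (ν ℤ.+ 1ℤ) ≡ ν′ ℤ.- ν
↘-shift ν ν′ = begin
  (ν′ ℤ.+ 1ℤ) ℤ.+ (ℤ.- (ν ℤ.+ 1ℤ))        ≡⟨ cong (ℤ._+_ (ν′ ℤ.+ 1ℤ)) (ℤ.neg-distrib-+ ν 1ℤ) ⟩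
  (ν′ ℤ.+ 1ℤ) ℤ.+ (ℤ.- ν ℤ.+ -1ℤ)          ≡⟨ interchange ν′ 1ℤ (ℤ.- ν) -1ℤ ⟩
  (ν′ ℤ.- ν) ℤ.+ 0ℤ                         ≡⟨ ℤ.+-identityʳ _ ⟩
  ν′ ℤ.- ν                                  ∎
  where open ≡-Reasoning

linked-shift : ∀ l → Linked _↘_ (map (ℤ._+ 1ℤ) l) ⇔ Linked _↘_ l
linked-shift l = mk⇔
  (Linked.map (λ {ν} {ν′} → subst (-1ℤ ℤ.≤_) (↘-shift ν ν′)) ∘ Linked.map⁻)
  (Linked.map⁺ ∘ Linked.map (λ {ν} {ν′} → subst (-1ℤ ℤ.≤_) (sym (↘-shift ν ν′))))

linked-split : ∀ {R : ℤ → ℤ → Set} k {i l} →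
  Linked R (k ++ i ∷ l) ⇔ (Linked R (k ++ i ∷ []) × Linked R (i ∷ l))
linked-split {R} k = mk⇔ (λ rs → left k rs , right k rs) (λ { (rs , ss) → join k rs ss })
  where
  left : ∀ k {i l} → Linked R (k ++ i ∷ l) → Linked R (k ++ i ∷ [])
  left []          _        = [-]
  left (_ ∷ [])    (r ∷ _)  = r ∷ [-]
  left (_ ∷ j ∷ k) (r ∷ rs) = r ∷ left (j ∷ k) rs
  right : ∀ k {i l} → Linked R (k ++ i ∷ l) → Linked R (i ∷ l)
  right []      rs = rs
  right (_ ∷ k) rs = right k (Linked.tail rs)
  join : ∀ k {i l} → Linked R (k ++ i ∷ []) → Linked R (i ∷ l) → Linked R (k ++ i ∷ l)
  join []          _        ss = ss
  join (_ ∷ [])    (r ∷ _)  ss = r ∷ ss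
  join (_ ∷ j ∷ k) (r ∷ rs) ss = r ∷ join (j ∷ k) rs ss

-- The class of all (-1)-Dyck paths and that of the low ones, whose last valley, if
-- any, has level 0.  For a nonnegative level ν the condition ν ↘ -1 says that ν is
-- 0, so appending -1 to the levels expresses lowness.
data Class : Set where
  all low : Class

sentinel : Class → List ℤ
sentinel all = []
sentinel low = -1ℤ ∷ []

-- The valley condition of the class, with the sentinel appended to the levels.
Steady : Class → Path → Set
Steady c p = Linked _↘_ (levels p ++ sentinel c)

open Equivalence using (to; from)

↘-zero : ∀ {ν} → -1ℤ ℤ.≤ ν → 0ℤ ↘ ν
↘-zero {ν} = subst (-1ℤ ℤ.≤_) (sym (ℤ.+-identityʳ ν))

linked-zero : ∀ c {l} → All (0ℤ ℤ.≤_) l →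
  Linked _↘_ (l ++ sentinel c) → Linked _↘_ (0ℤ ∷ l ++ sentinel c)
linked-zero all []        _  = [-]
linked-zero low []        _  = ↘-zero ℤ.≤-refl ∷ [-]
linked-zero c   (0≤ν ∷ _) rs = ↘-zero (ℤ.≤-trans ℤ.-≤+ 0≤ν) ∷ rs

-- The level 0 of the valley after A, less the shift by one of the levels of A,
-- acts as the sentinel -1 for A.
steady-node : ∀ c {A q} → Dyck A → Dyck (U ∷ q) →
  Steady c (node A (U ∷ q)) ⇔ (Steady low A × Steady c (U ∷ q))
steady-node c {A} {q} α β = mk⇔ apart together
  where
  shifted = map (ℤ._+ 1ℤ) (levels A)
  split : levels (node A (U ∷ q)) ++ sentinel c ≡ shifted ++ 0ℤ ∷ levels (U ∷ q) ++ sentinel c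
  split = trans (cong (_++ sentinel c) (levels-node α q)) (List.++-assoc shifted _ (sentinel c))
  joined : shifted ++ 0ℤ ∷ [] ≡ map (ℤ._+ 1ℤ) (levels A ++ sentinel low)
  joined = sym (List.map-++ (ℤ._+ 1ℤ) (levels A) (sentinel low))
  apart : Steady c (node A (U ∷ q)) → Steady low A × Steady c (U ∷ q)
  apart rs with to (linked-split shifted) (subst (Linked _↘_) split rs)
  ... | rs₁ , rs₂ = to (linked-shift _) (subst (Linked _↘_) joined rs₁) , Linked.tail rs₂
  together : Steady low A × Steady c (U ∷ q) → Steady c (node A (U ∷ q))
  together (rs₁ , rs₂) = subst (Linked _↘_) (sym split) (from (linked-split shifted)
    (subst (Linked _↘_) (sym joined) (from (linked-shift _) rs₁) , linked-zero c (levels-nonneg β) rs₂))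

steady-hill-all : ∀ A → Steady all (node A []) ⇔ Steady all A
steady-hill-all A = mk⇔
  (to (linked-shift _) ∘ subst (Linked _↘_) eq)
  (subst (Linked _↘_) (sym eq) ∘ from (linked-shift _))
  where
  eq : levels (node A []) ++ [] ≡ map (ℤ._+ 1ℤ) (levels A ++ [])
  eq = trans (cong (_++ []) (levels-hill A)) (sym (List.map-++ (ℤ._+ 1ℤ) (levels A) []))

-- A level raised by one is at least 1, too high to precede the sentinel.
no-levels : ∀ {l} → All (0ℤ ℤ.≤_) l → Linked _↘_ (map (ℤ._+ 1ℤ) l ++ sentinel low) → l ≡ []
no-levels []                    _        = refl
no-levels {ν ∷ []} (0≤ν ∷ []) (r ∷ _)  = contradiction (ℤ.≤-trans r bound) λ { (ℤ.-≤- ()) }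
  where
  bound : -1ℤ ℤ.- (ν ℤ.+ 1ℤ) ℤ.≤ -1ℤ ℤ.- 1ℤ
  bound = ℤ.+-monoʳ-≤ -1ℤ (ℤ.neg-mono-≤ (ℤ.+-monoˡ-≤ 1ℤ 0≤ν))
no-levels (_ ∷ ≥0@(_ ∷ _)) (_ ∷ rs) with () ← no-levels ≥0 rs

-- The path of n up steps followed by n down steps.
pyramid : ℕ → Path
pyramid zero    = []
pyramid (suc n) = node (pyramid n) []

pyramid-dyck : ∀ n → Dyck (pyramid n)
pyramid-dyck zero    = empty
pyramid-dyck (suc n) = return (pyramid-dyck n) empty

pyramid-levels : ∀ n → levels (pyramid n) ≡ []
pyramid-levels zero    = refl
pyramid-levels (suc n) = trans (levels-hill (pyramid n)) (cong (map _) (pyramid-levels n))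

pyramid-semilength : ∀ n → semilength (pyramid n) ≡ n
pyramid-semilength zero    = refl
pyramid-semilength (suc n) = cong suc (trans (semilength-++ (pyramid n) (D ∷ []))
  (trans (ℕ.+-identityʳ _) (pyramid-semilength n)))

no-levels⇒pyramid : Dyck A → levels A ≡ [] → A ≡ pyramid (semilength A)
no-levels⇒pyramid empty                _  = refl
no-levels⇒pyramid (return {A} α empty) eq = begin
  node A []
    ≡⟨ cong (λ p → node p []) (no-levels⇒pyramid α (map≡[] (trans (sym (levels-hill A)) eq))) ⟩
  pyramid (suc (semilength A))
    ≡⟨ cong (pyramid ∘ suc) (trans (semilength-++ A (D ∷ [])) (ℕ.+-identityʳ _)) ⟨
  pyramid (semilength (node A [])) ∎
  where
  open ≡-Reasoning
  map≡[] : ∀ {l} → map (ℤ._+ 1ℤ) l ≡ [] → l ≡ []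
  map≡[] {[]} _ = refl
no-levels⇒pyramid (return {A} α (return _ _)) eq
  with () ← List.++-conicalʳ (map (ℤ._+ 1ℤ) (levels A)) _ (trans (sym (levels-node α _)) eq)

steady-hill-low : Dyck A → Steady low (node A []) ⇔ A ≡ pyramid (semilength A)
steady-hill-low {A} α = mk⇔
  (λ rs → no-levels⇒pyramid α (no-levels (levels-nonneg α) (subst LowLevels (levels-hill A) rs)))
  (λ eq → subst LowLevels (sym (trans (levels-hill A) (cong (map _)
    (trans (cong levels eq) (pyramid-levels (semilength A)))))) [-])
  where
  LowLevels : List ℤ → Set
  LowLevels l = Linked _↘_ (l ++ sentinel low)

-- The decomposition of the two classes

InClass : Class → Path → Set
InClass c p = IsDyck p × Steady c p

inClass? : ∀ c p → Dec (InClass c p)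
inClass? c p = (All.all? (0ℤ ℤ.≤?_) (ordinates 0ℤ p) ×-dec foldl _▹_ 0ℤ p ℤ.≟ 0ℤ)
  ×-dec Linked.linked? (λ ν ν′ → -1ℤ ℤ.≤? ν′ ℤ.- ν) (levels p ++ sentinel c)

-- Opaque, so that c and n can be inferred from `paths c n`.
opaque
  -- The paths of semi-length n in the class.
  paths : Class → ℕ → List Path
  paths c n = filter (λ p → inClass? c p ×-dec semilength p ℕ.≟ n) (words (2 ℕ.* n))

  ∈-paths : ∀ {c n p} → p ∈ paths c n ⇔ (InClass c p × semilength p ≡ n)
  ∈-paths {c} {n} {p} = mk⇔ (proj₂ ∘ ∈-filter⁻ P? {xs = words (2 ℕ.* n)}) complete
    where
    P? : ∀ p → Dec (InClass c p × semilength p ≡ n)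
    P? p = inClass? c p ×-dec semilength p ℕ.≟ n
    complete : InClass c p × semilength p ≡ n → p ∈ paths c n
    complete ((dyck , steady) , refl) = ∈-filter⁺ P?
      (subst (λ m → p ∈ words m) (dyck-length {p} dyck) (words-complete p))
      ((dyck , steady) , refl)

  paths-unique : ∀ c n → Unique (paths c n)
  paths-unique c n = Unique.filter⁺ _ (words-unique (2 ℕ.* n))

  minusOneDyckPaths≡ : ∀ n → minusOneDyckPaths n ≡ paths all n
  minusOneDyckPaths≡ n = List.filter-≐ _ _
    ( (λ {p} → λ { ((δ , rs) , eq) → (δ , subst (Linked _↘_) (sym (no-sentinel p)) rs) , eq })
    , (λ {p} → λ { ((δ , rs) , eq) → (δ , subst (Linked _↘_) (no-sentinel p) rs) , eq }) )
    (words (2 ℕ.* n))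
    where
    no-sentinel : ∀ p → levels p ++ [] ≡ levels p
    no-sentinel p = List.++-identityʳ (levels p)

  paths-zero : ∀ c → paths c 0 ≡ [] ∷ []
  paths-zero all = refl
  paths-zero low = refl

-- The nonempty paths of the class.
nonempty : Class → ℕ → List Path
nonempty c zero    = []
nonempty c (suc n) = paths c (suc n)

-- The paths A of semi-length n for which U A D belongs to the class.
inner : Class → ℕ → List Path
inner all n = paths all n
inner low n = pyramid n ∷ []

-- The pairs of a low path A of semi-length i and a nonempty path B of semi-length
-- n - i in the class; these are the pairs with B nonempty for which U A D B, of
-- semi-length n + 1, belongs to the class.
products : Class → ∀ n → Fin (suc n) → List (Path × Path)
products c n i = cartesianProduct (paths low (toℕ i)) (nonempty c (n ℕ.∸ toℕ i))

-- The first return decompositions of the paths of semi-length n + 1 in the class.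
decompositions : Class → ℕ → List (Path × Path)
decompositions c n = map (_, []) (inner c n) ++ concat (tabulate (products c n))

map-unique : ∀ {S T : Set} {f : S → T} {xs} →
  (∀ {x y} → x ∈ xs → y ∈ xs → f x ≡ f y → x ≡ y) → Unique xs → Unique (map f xs)
map-unique inj []             = []
map-unique inj (x∉xs ∷ uniq) =
  All.map⁺ (All.tabulate λ y∈xs fx≡fy →
    All.lookup x∉xs y∈xs (inj (here refl) (there y∈xs) fx≡fy))
    ∷ map-unique (λ x∈xs y∈xs → inj (there x∈xs) (there y∈xs)) uniq

∈-paths-dyck : ∀ {c n} → p ∈ paths c n → Dyck p
∈-paths-dyck {p} p∈ = isDyck⇒dyck {p} (proj₁ (proj₁ (to ∈-paths p∈)))

∈-paths-steady : ∀ {c n} → p ∈ paths c n → Steady c p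
∈-paths-steady p∈ = proj₂ (proj₁ (to ∈-paths p∈))

∈-paths-semilength : ∀ {c n} → p ∈ paths c n → semilength p ≡ n
∈-paths-semilength p∈ = proj₂ (to ∈-paths p∈)

∈-paths⁺ : ∀ {c n} → Dyck p → Steady c p → semilength p ≡ n → p ∈ paths c n
∈-paths⁺ δ steady len = from ∈-paths ((dyck⇒isDyck δ , steady) , len)

∈-nonempty⁻ : ∀ c n → p ∈ nonempty c n → p ∈ paths c n × ∃ λ q → p ≡ U ∷ q
∈-nonempty⁻ c (suc n) p∈ with ∈-paths-dyck p∈ | ∈-paths-semilength p∈
... | return α β | _ = p∈ , _ , refl
... | empty      | ()

∈-nonempty⁺ : ∀ c n → U ∷ q ∈ paths c n → U ∷ q ∈ nonempty c n
∈-nonempty⁺ c (suc n) p∈ = p∈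
∈-nonempty⁺ c zero    p∈ with () ← ∈-paths-semilength p∈

nonempty-unique : ∀ c n → Unique (nonempty c n)
nonempty-unique c zero    = []
nonempty-unique c (suc n) = paths-unique c (suc n)

inner-dyck : ∀ c {n} → p ∈ inner c n → Dyck p
inner-dyck all p∈          = ∈-paths-dyck p∈
inner-dyck low (here refl) = pyramid-dyck _

inner-semilength : ∀ c {n} → p ∈ inner c n → semilength p ≡ n
inner-semilength all p∈              = ∈-paths-semilength p∈
inner-semilength low {n} (here refl) = pyramid-semilength n

inner-unique : ∀ c n → Unique (inner c n)
inner-unique all n = paths-unique all n
inner-unique low n = [] ∷ []

steady-hill : ∀ c {n} → Dyck A → semilength A ≡ n → Steady c (node A []) ⇔ A ∈ inner c n
steady-hill {A} all α refl = mk⇔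
  (λ rs → ∈-paths⁺ α (to (steady-hill-all A) rs) refl)
  (λ A∈ → from (steady-hill-all A) (∈-paths-steady A∈))
steady-hill low α refl = mk⇔
  (λ rs → here (to (steady-hill-low α) rs))
  (λ { (here eq) → from (steady-hill-low α) eq ; (there ()) })

∈-products⁻ : ∀ c n i → (A , B) ∈ products c n i →
  A ∈ paths low (toℕ i) × B ∈ nonempty c (n ℕ.∸ toℕ i)
∈-products⁻ c n i = ∈-cartesianProduct⁻ (paths low (toℕ i)) (nonempty c (n ℕ.∸ toℕ i))

-- Membership in `decompositions c n`, as an inductive family.
data Decomposition (c : Class) (n : ℕ) : Path × Path → Set where
  hill    : A ∈ inner c n → Decomposition c n (A , [])
  product : ∀ i → (A , B) ∈ products c n i → Decomposition c n (A , B)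

∈-decompositions : ∀ c n {x} → x ∈ decompositions c n ⇔ Decomposition c n x
∈-decompositions c n = mk⇔ classify member
  where
  classify : ∀ {x} → x ∈ decompositions c n → Decomposition c n x
  classify x∈ with ∈-++⁻ (map (_, []) (inner c n)) x∈
  ... | inj₁ x∈hills with ∈-map⁻ (_, []) x∈hills
  ...   | A , A∈ , refl = hill A∈
  classify x∈ | inj₂ x∈products with ∈-concat⁻′ (tabulate (products c n)) x∈products
  ...   | xs , x∈xs , xs∈ with ∈-tabulate⁻ {f = products c n} xs∈
  ...     | i , refl = product i x∈xs
  member : ∀ {x} → Decomposition c n x → x ∈ decompositions c n
  member (hill A∈)      = ∈-++⁺ˡ (∈-map⁺ (_, []) A∈)
  member (product i x∈) = ∈-++⁺ʳ (map (_, []) (inner c n))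
    (∈-concat⁺′ x∈ (∈-tabulate⁺ {f = products c n} i))

decomposition-dyck : ∀ {c n} → Decomposition c n (A , B) → Dyck A
decomposition-dyck {c = c}         (hill A∈)      = inner-dyck c A∈
decomposition-dyck {c = c} {n = n} (product i x∈) = ∈-paths-dyck (proj₁ (∈-products⁻ c n i x∈))

decompositions-unique : ∀ c n → Unique (decompositions c n)
decompositions-unique c n = Unique.++⁺
  (Unique.map⁺ ,-injectiveˡ (inner-unique c n))
  (Unique.concat⁺
    (All.tabulate⁺ λ i → Unique.cartesianProduct⁺
      (paths-unique low (toℕ i)) (nonempty-unique c (n ℕ.∸ toℕ i)))
    -- The index i is the semi-length of the first component.
    (AllPairs.tabulate⁺ λ {i} {j} i≢j → λ { (x∈ , x∈′) → i≢j (Fin.toℕ-injective (trans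
      (sym (∈-paths-semilength (proj₁ (∈-products⁻ c n i x∈))))
      (∈-paths-semilength (proj₁ (∈-products⁻ c n j x∈′))))) }))
  disjoint
  where
  disjoint : Disjoint (map (_, []) (inner c n)) (concat (tabulate (products c n)))
  disjoint (x∈ , x∈′) with ∈-map⁻ (_, []) x∈ | ∈-concat⁻′ (tabulate (products c n)) x∈′
  ... | A , _ , refl | xs , x∈xs , xs∈ with ∈-tabulate⁻ {f = products c n} xs∈
  ...   | i , refl with ∈-nonempty⁻ c (n ℕ.∸ toℕ i) (proj₂ (∈-products⁻ c n i x∈xs))
  ...     | _ , _ , ()

semilength-node : ∀ A B → semilength (node A B) ≡ suc (semilength A ℕ.+ semilength B)
semilength-node A B = cong suc (semilength-++ A (D ∷ B))

node-∈-paths : ∀ {c n} → Decomposition c n (A , B) → node A B ∈ paths c (suc n)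
node-∈-paths {A} {c = c} (hill A∈) = ∈-paths⁺ (return α empty)
  (from (steady-hill c α (inner-semilength c A∈)) A∈)
  (trans (semilength-node A []) (cong suc (trans (ℕ.+-identityʳ _) (inner-semilength c A∈))))
  where α = inner-dyck c A∈
node-∈-paths {A} {B} {c} {n} (product i x∈) with ∈-products⁻ c n i x∈
... | A∈ , B∈⁺ with ∈-nonempty⁻ c (n ℕ.∸ toℕ i) B∈⁺
...   | B∈ , q , refl = ∈-paths⁺ (return α β)
  (from (steady-node c α β) (∈-paths-steady A∈ , ∈-paths-steady B∈))
  (trans (semilength-node A (U ∷ q)) (cong suc (trans
    (cong₂ ℕ._+_ (∈-paths-semilength A∈) (∈-paths-semilength B∈))
    (ℕ.m+[n∸m]≡n (Fin.toℕ≤pred[n] i)))))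
  where
  α = ∈-paths-dyck A∈
  β = ∈-paths-dyck B∈

paths-decomposition : ∀ {c n} → p ∈ paths c (suc n) → p ∈ map (uncurry node) (decompositions c n)
paths-decomposition {c = c} {n} p∈
  with ∈-paths-steady p∈ | ∈-paths-semilength p∈ | ∈-paths-dyck p∈
... | rs | len | return {A} α empty =
  ∈-map⁺ (uncurry node) (from (∈-decompositions c n) (hill (to (steady-hill c α |A|≡n) rs)))
  where
  |A|≡n : semilength A ≡ n
  |A|≡n = trans (sym (ℕ.+-identityʳ _)) (ℕ.suc-injective (trans (sym (semilength-node A [])) len))
... | rs | len | return {A} {B} α β@(return _ _) =
  ∈-map⁺ (uncurry node) (from (∈-decompositions c n) (product i (∈-cartesianProduct⁺
    (∈-paths⁺ α (proj₁ steady) (sym i≡|A|))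
    (∈-nonempty⁺ c (n ℕ.∸ toℕ i) (∈-paths⁺ β (proj₂ steady) |B|≡n∸i)))))
  where
  steady = to (steady-node c α β) rs
  |A|+|B|≡n : semilength A ℕ.+ semilength B ≡ n
  |A|+|B|≡n = ℕ.suc-injective (trans (sym (semilength-node A B)) len)
  |A|<1+n : semilength A ℕ.< suc n
  |A|<1+n = ℕ.s≤s (subst (semilength A ℕ.≤_) |A|+|B|≡n (ℕ.m≤m+n (semilength A) (semilength B)))
  i = fromℕ< |A|<1+n
  i≡|A| : toℕ i ≡ semilength A
  i≡|A| = Fin.toℕ-fromℕ< |A|<1+n
  |B|≡n∸i : semilength B ≡ n ℕ.∸ toℕ i
  |B|≡n∸i = trans (sym (ℕ.m+n∸m≡n (semilength A) (semilength B)))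
    (cong₂ ℕ._∸_ |A|+|B|≡n (sym i≡|A|))

-- Both lists are free of repetitions, so it suffices that they have the same
-- elements.
paths-decompose : ∀ c n → paths c (suc n) ↭ map (uncurry node) (decompositions c n)
paths-decompose c n = ∼bag⇒↭ (unique∧set⇒bag (paths-unique c (suc n))
  (map-unique injective (decompositions-unique c n))
  (mk⇔ paths-decomposition λ p∈ → node∈ (∈-map⁻ (uncurry node) p∈)))
  where
  node∈ : (∃ λ x → x ∈ decompositions c n × p ≡ uncurry node x) → p ∈ paths c (suc n)
  node∈ (_ , x∈ , refl) = node-∈-paths (to (∈-decompositions c n) x∈)
  dyck : ∀ {x} → x ∈ decompositions c n → Dyck (proj₁ x)
  dyck x∈ = decomposition-dyck (to (∈-decompositions c n) x∈)
  injective : ∀ {x y} → x ∈ decompositions c n → y ∈ decompositions c n →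
    uncurry node x ≡ uncurry node y → x ≡ y
  injective x∈ y∈ = node-injective (dyck x∈) (dyck y∈)

-- Sums over lists of paths

∑ : ∀ {S : Set} → (S → ℚ) → List S → ℚ
∑ w []       = 0ℚ
∑ w (x ∷ xs) = w x ℚ.+ ∑ w xs

∑-cong : ∀ {S : Set} {v w : S → ℚ} xs → (∀ {x} → x ∈ xs → v x ≡ w x) → ∑ v xs ≡ ∑ w xs
∑-cong []       v≡w = refl
∑-cong (x ∷ xs) v≡w = cong₂ ℚ._+_ (v≡w (here refl)) (∑-cong xs (v≡w ∘ there))

∑-++ : ∀ {S : Set} (w : S → ℚ) xs ys → ∑ w (xs ++ ys) ≡ ∑ w xs ℚ.+ ∑ w ys
∑-++ w []       ys = sym (ℚ.+-identityˡ _)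
∑-++ w (x ∷ xs) ys = trans (cong (w x ℚ.+_) (∑-++ w xs ys)) (sym (ℚ.+-assoc (w x) _ _))

∑-map : ∀ {S T : Set} (w : T → ℚ) (f : S → T) xs → ∑ w (map f xs) ≡ ∑ (w ∘ f) xs
∑-map w f []       = refl
∑-map w f (x ∷ xs) = cong (w (f x) ℚ.+_) (∑-map w f xs)

∑-concat-tabulate : ∀ {S : Set} (w : S → ℚ) {n} (f : Fin n → List S) →
  ∑ w (concat (tabulate f)) ≡ sum (λ i → ∑ w (f i))
∑-concat-tabulate w {zero}  f = refl
∑-concat-tabulate w {suc n} f = trans (∑-++ w (f Fin.zero) _)
  (cong (∑ w (f Fin.zero) ℚ.+_) (∑-concat-tabulate w (f ∘ Fin.suc)))

∑-↭ : ∀ {S : Set} (w : S → ℚ) {xs ys} → xs ↭ ys → ∑ w xs ≡ ∑ w ys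
∑-↭ w Perm.refl                   = refl
∑-↭ w (Perm.prep x p)             = cong (w x ℚ.+_) (∑-↭ w p)
∑-↭ w (Perm.swap {xs} {ys} x y p) = begin
  w x ℚ.+ (w y ℚ.+ ∑ w xs)   ≡⟨ cong (λ s → w x ℚ.+ (w y ℚ.+ s)) (∑-↭ w p) ⟩
  w x ℚ.+ (w y ℚ.+ ∑ w ys)
    ≡⟨ solve three (λ x y z → x :+ (y :+ z) := y :+ (x :+ z)) refl (w x) (w y) (∑ w ys) ⟩
  w y ℚ.+ (w x ℚ.+ ∑ w ys)   ∎
  where open ≡-Reasoning
∑-↭ w (Perm.trans p q)            = trans (∑-↭ w p) (∑-↭ w q)

∑-+ : ∀ {S : Set} (v w : S → ℚ) xs → ∑ (λ x → v x ℚ.+ w x) xs ≡ ∑ v xs ℚ.+ ∑ w xs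
∑-+ v w []       = refl
∑-+ v w (x ∷ xs) = trans (cong (v x ℚ.+ w x ℚ.+_) (∑-+ v w xs))
  (solve four (λ i j k l → i :+ j :+ (k :+ l) := i :+ k :+ (j :+ l)) refl
    (v x) (w x) (∑ v xs) (∑ w xs))

∑-scale : ∀ {S : Set} q (w : S → ℚ) xs → ∑ (λ x → q ℚ.* w x) xs ≡ q ℚ.* ∑ w xs
∑-scale q w []       = sym (ℚ.*-zeroʳ q)
∑-scale q w (x ∷ xs) =
  trans (cong (q ℚ.* w x ℚ.+_) (∑-scale q w xs)) (sym (ℚ.*-distribˡ-+ q (w x) _))

∑-cartesianProduct : ∀ {S T : Set} (v : S → ℚ) (w : T → ℚ) xs ys →
  ∑ (λ (x , y) → v x ℚ.* w y) (cartesianProduct xs ys) ≡ ∑ v xs ℚ.* ∑ w ys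
∑-cartesianProduct v w []       ys = sym (ℚ.*-zeroˡ (∑ w ys))
∑-cartesianProduct v w (x ∷ xs) ys = begin
  ∑ vw (map (x ,_) ys ++ cartesianProduct xs ys)
    ≡⟨ ∑-++ vw (map (x ,_) ys) _ ⟩
  ∑ vw (map (x ,_) ys) ℚ.+ ∑ vw (cartesianProduct xs ys)
    ≡⟨ cong₂ ℚ._+_ (trans (∑-map vw (x ,_) ys) (∑-scale (v x) w ys)) (∑-cartesianProduct v w xs ys) ⟩
  v x ℚ.* ∑ w ys ℚ.+ ∑ v xs ℚ.* ∑ w ys
    ≡⟨ ℚ.*-distribʳ-+ (∑ w ys) (v x) (∑ v xs) ⟨
  (v x ℚ.+ ∑ v xs) ℚ.* ∑ w ys ∎
  where
  open ≡-Reasoning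
  vw = λ (x , y) → v x ℚ.* w y

fromℤ-sum : ∀ {S : Set} (w : S → ℤ) xs → fromℤ (foldr ℤ._+_ 0ℤ (map w xs)) ≡ ∑ (fromℤ ∘ w) xs
fromℤ-sum w []       = refl
fromℤ-sum w (x ∷ xs) = trans (fromℤ-+ (w x) _) (cong (fromℤ (w x) ℚ.+_) (fromℤ-sum w xs))

-- The equations for the generating functions

-- The generating function of a sequence of lists of paths, with weight w.
gf : (Path → ℚ) → (ℕ → List Path) → Series
gf w ps n = ∑ w (ps n)

unit areaℚ : Path → ℚ
unit  p = 1ℚ
areaℚ p = fromℤ (area p)

-- The series of the numbers of paths and of their total areas.
count total : (ℕ → List Path) → Series
count = gf unit
total = gf areaℚ

-- The area of a Dyck path of semi-length n after raising it by one.  The factor 1ℚ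
-- makes the second summand a multiple of `unit`.
raisedArea : ℕ → Path → ℚ
raisedArea n p = areaℚ p ℚ.+ fromℤ (ℤ.+ suc (2 ℕ.* n)) ℚ.* 1ℚ

∑-raisedArea : ∀ ps n → ∑ (raisedArea n) (ps n) ≡ raised (total ps) (count ps) n
∑-raisedArea ps n = begin
  ∑ (raisedArea n) (ps n)                       ≡⟨ ∑-+ areaℚ _ (ps n) ⟩
  total ps n ℚ.+ ∑ (λ p → N ℚ.* 1ℚ) (ps n)      ≡⟨ cong (total ps n ℚ.+_) (∑-scale N unit (ps n)) ⟩
  total ps n ℚ.+ N ℚ.* u                        ≡⟨ cong (λ q → total ps n ℚ.+ q ℚ.* u) N≡ ⟩
  total ps n ℚ.+ (1ℚ ℚ.+ fromℤ 2 ℚ.* fromℤ (ℤ.+ n)) ℚ.* u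
    ≡⟨ solve three (λ v n u → v :+ (con 1ℚ :+ con (fromℤ 2) :* n) :* u
         := v :+ (con (fromℤ 2) :* (n :* u) :+ u)) refl (total ps n) (fromℤ (ℤ.+ n)) u ⟩
  total ps n ℚ.+ (fromℤ 2 ℚ.* (fromℤ (ℤ.+ n) ℚ.* u) ℚ.+ u)
    ≡⟨ cong (λ q → total ps n ℚ.+ (q ℚ.+ u)) (constant-* 2 (θ (count ps)) n) ⟨
  raised (total ps) (count ps) n                ∎
  where
  open ≡-Reasoning
  N = fromℤ (ℤ.+ suc (2 ℕ.* n))
  u = count ps n
  N≡ : N ≡ 1ℚ ℚ.+ fromℤ 2 ℚ.* fromℤ (ℤ.+ n)
  N≡ = trans (fromℤ-+ 1ℤ (ℤ.+ (2 ℕ.* n))) (cong (1ℚ ℚ.+_)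
    (trans (cong fromℤ (ℤ.pos-* 2 n)) (fromℤ-* 2 (ℤ.+ n))))

areaℚ-node : ∀ {n} → Dyck A → semilength A ≡ n → ∀ B →
  areaℚ (node A B) ≡ raisedArea n A ℚ.+ areaℚ B
areaℚ-node {A} α refl B = begin
  fromℤ (area (node A B))                     ≡⟨ cong fromℤ (area-node α B) ⟩
  fromℤ (area A ℤ.+ N ℤ.+ area B)             ≡⟨ fromℤ-+ (area A ℤ.+ N) (area B) ⟩
  fromℤ (area A ℤ.+ N) ℚ.+ areaℚ B
    ≡⟨ cong (ℚ._+ areaℚ B) (trans (fromℤ-+ (area A) N)
         (cong (areaℚ A ℚ.+_) (sym (ℚ.*-identityʳ (fromℤ N))))) ⟩
  raisedArea (semilength A) A ℚ.+ areaℚ B     ∎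
  where
  open ≡-Reasoning
  N = ℤ.+ suc (2 ℕ.* semilength A)

∑-decompositions : ∀ w c n → ∑ w (paths c (suc n)) ≡
  ∑ (λ A → w (node A [])) (inner c n) ℚ.+ sum {suc n} λ i → ∑ (w ∘ uncurry node) (products c n i)
∑-decompositions w c n = begin
  ∑ w (paths c (suc n))
    ≡⟨ ∑-↭ w (paths-decompose c n) ⟩
  ∑ w (map (uncurry node) (decompositions c n))
    ≡⟨ ∑-map w (uncurry node) (decompositions c n) ⟩
  ∑ w′ (decompositions c n)
    ≡⟨ ∑-++ w′ (map (_, []) (inner c n)) _ ⟩
  ∑ w′ (map (_, []) (inner c n)) ℚ.+ ∑ w′ (concat (tabulate (products c n)))
    ≡⟨ cong₂ ℚ._+_ (∑-map w′ (_, []) (inner c n)) (∑-concat-tabulate w′ (products c n)) ⟩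
  ∑ (λ A → w (node A [])) (inner c n) ℚ.+ sum {suc n} (λ i → ∑ w′ (products c n i)) ∎
  where
  open ≡-Reasoning
  w′ = w ∘ uncurry node

count-tail : ∀ c → tail (count (nonempty c)) ≗
  count (inner c) + count (paths low) * count (nonempty c)
count-tail c n = trans (∑-decompositions unit c n)
  (cong (count (inner c) n ℚ.+_) (sum-cong-≗ {suc n} λ i →
    ∑-cartesianProduct unit unit (paths low (toℕ i)) (nonempty c (n ℕ.∸ toℕ i))))

area-tail : ∀ c → tail (total (nonempty c)) ≗
  raised (total (inner c)) (count (inner c))
    + (raised (total (paths low)) (count (paths low)) * count (nonempty c)
       + count (paths low) * total (nonempty c))
area-tail c n = trans (∑-decompositions areaℚ c n) (cong₂ ℚ._+_ hills (begin
  sum {suc n} (λ i → ∑ (areaℚ ∘ uncurry node) (products c n i))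
    ≡⟨ sum-cong-≗ {suc n} summand ⟩
  sum {suc n} (λ i → raised-A i ℚ.+ raised-B i)
    ≡⟨ ∑-distrib-+ {suc n} raised-A raised-B ⟩
  (l * count (nonempty c)) n ℚ.+ (count (paths low) * total (nonempty c)) n ∎))
  where
  open ≡-Reasoning
  l = raised (total (paths low)) (count (paths low))
  -- The contributions of A and B to the area of U A D B, for A of semi-length i.
  raised-A raised-B : Fin (suc n) → ℚ
  raised-A i = l (toℕ i) ℚ.* count (nonempty c) (n ℕ.∸ toℕ i)
  raised-B i = count (paths low) (toℕ i) ℚ.* total (nonempty c) (n ℕ.∸ toℕ i)
  hills : ∑ (λ A → areaℚ (node A [])) (inner c n) ≡ raised (total (inner c)) (count (inner c)) n
  hills = trans
    (∑-cong (inner c n) λ {A} A∈ →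
      trans (areaℚ-node (inner-dyck c A∈) (inner-semilength c A∈) []) (ℚ.+-identityʳ (raisedArea n A)))
    (∑-raisedArea (inner c) n)
  summand : ∀ i → ∑ (areaℚ ∘ uncurry node) (products c n i) ≡ raised-A i ℚ.+ raised-B i
  summand i = begin
    ∑ (areaℚ ∘ uncurry node) (products c n i)
      ≡⟨ ∑-cong (products c n i) (λ {(A , B)} x∈ → let A∈ , _ = ∈-products⁻ c n i x∈ in
           trans (areaℚ-node (∈-paths-dyck A∈) (∈-paths-semilength A∈) B)
             (sym (cong₂ ℚ._+_ (ℚ.*-identityʳ (raisedArea (toℕ i) A)) (ℚ.*-identityˡ (areaℚ B))))) ⟩
    ∑ (λ x → area-A x ℚ.+ area-B x) (products c n i)
      ≡⟨ ∑-+ area-A area-B (products c n i) ⟩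
    ∑ area-A (products c n i) ℚ.+ ∑ area-B (products c n i)
      ≡⟨ cong₂ ℚ._+_
           (trans (∑-cartesianProduct (raisedArea (toℕ i)) unit (paths low (toℕ i)) Bs)
             (cong (ℚ._* count (nonempty c) (n ℕ.∸ toℕ i)) (∑-raisedArea (paths low) (toℕ i))))
           (∑-cartesianProduct unit areaℚ (paths low (toℕ i)) Bs) ⟩
    raised-A i ℚ.+ raised-B i ∎
    where
    Bs = nonempty c (n ℕ.∸ toℕ i)
    area-A area-B : Path × Path → ℚ
    area-A (A , B) = raisedArea (toℕ i) A ℚ.* 1ℚ
    area-B (A , B) = 1ℚ ℚ.* areaℚ B

count-split : ∀ c → count (paths c) ≗ 1# + count (nonempty c)
count-split c zero    = cong (∑ unit) (paths-zero c)
count-split c (suc n) = sym (ℚ.+-identityˡ _)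

-- The empty path has area 0.
area-split : ∀ c → total (paths c) ≗ total (nonempty c)
area-split c zero    = cong (∑ areaℚ) (paths-zero c)
area-split c (suc n) = refl

raised-cong : ∀ {v v′} f → v ≗ v′ → raised v f ≗ raised v′ f
raised-cong f v≗ n = cong (ℚ._+ points f n) (v≗ n)

count-equation : ∀ c → count (nonempty c) ≗ X *
  (count (inner c) + count (paths low) * count (nonempty c))
count-equation c = tail-≗ _ _ refl (count-tail c)

area-equation : ∀ c {v} → total (inner c) ≗ v → total (nonempty c) ≗ X *
  (raised v (count (inner c))
    + (raised (total (nonempty low)) (count (paths low)) * count (nonempty c)
       + count (paths low) * total (nonempty c)))
area-equation c {v} inner≗v = tail-≗ _ _ refl λ n → trans (area-tail c n) (cong₂ ℚ._+_
  (raised-cong (count (inner c)) inner≗v n)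
  (cong (ℚ._+ (count (paths low) * total (nonempty c)) n)
    (*-congʳ {raised (total (paths low)) (count (paths low))} (count (nonempty c))
      (raised-cong (count (paths low)) (area-split low)) n)))

pyramid-count : count (inner low) ≗ 1# + X * count (inner low)
pyramid-count zero    = sym (cong (1ℚ ℚ.+_) (X-*-zero (count (inner low))))
pyramid-count (suc n) = sym (trans (ℚ.+-identityˡ _) (X-*-suc (count (inner low)) n))

pyramid-area : total (inner low) ≗ X * raised (total (inner low)) (count (inner low))
pyramid-area = tail-≗ _ _ refl λ n → trans
  (cong (ℚ._+ 0ℚ) (trans (areaℚ-node (pyramid-dyck n) (pyramid-semilength n) [])
    (ℚ.+-identityʳ (raisedArea n (pyramid n)))))
  (∑-raisedArea (inner low) n)

area-≋ : total (nonempty all) ≋ areaSurd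
area-≋ = area-closed-form
  (count (inner low)) (total (inner low))
  (count (paths low)) (count (nonempty low)) (total (nonempty low))
  (count (paths all)) (count (nonempty all)) (total (nonempty all))
  pyramid-count pyramid-area
  (count-split low) (count-equation low) (area-equation low (λ _ → refl))
  (count-split all) (count-equation all) (area-equation all (area-split all))

V≗total : V ≗ total (nonempty all)
V≗total n = begin
  fromℤ (a n)                       ≡⟨ fromℤ-sum area (minusOneDyckPaths n) ⟩
  ∑ areaℚ (minusOneDyckPaths n)     ≡⟨ cong (∑ areaℚ) (minusOneDyckPaths≡ n) ⟩
  total (paths all) n               ≡⟨ area-split all n ⟩
  total (nonempty all) n            ∎
  where open ≡-Reasoning

-- The closed form of the area series

infixr 8 _^ₗ_

_^ₗ_ : List ℤ → ℕ → List ℤ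
k ^ₗ zero  = 1 ∷ []
k ^ₗ suc n = k ⊗ k ^ₗ n

poly-^ : ∀ k n → poly (k ^ₗ n) ≗ poly k ^ n
poly-^ k zero    i = refl
poly-^ k (suc n) i = trans (poly-⊗ k (k ^ₗ n) i) (*-congˡ (poly k) (poly-^ k n) i)

areaSurd-den : let k = 1 ∷ -1 ∷ [] ; l = 1 ∷ -4 ∷ 2 ∷ [] ; m = 1 ∷ -3 ∷ -1 ∷ -1 ∷ [] in
  poly (den areaSurd) ≗ poly k ^ 2 * poly l ^ 3 * poly m
areaSurd-den n = begin
  poly (den areaSurd) n              ≡⟨ ⟦⟧-≃ (den areaSurd) (k ^ₗ 2 ⊗ l ^ₗ 3 ⊗ m) n ⟩
  poly (k ^ₗ 2 ⊗ l ^ₗ 3 ⊗ m) n       ≡⟨ poly-⊗ (k ^ₗ 2 ⊗ l ^ₗ 3) m n ⟩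
  (poly (k ^ₗ 2 ⊗ l ^ₗ 3) * poly m) n
    ≡⟨ *-congʳ {poly (k ^ₗ 2 ⊗ l ^ₗ 3)} (poly m) (λ i → trans (poly-⊗ (k ^ₗ 2) (l ^ₗ 3) i)
         (*-cong {poly (k ^ₗ 2)} (poly-^ k 2) (poly-^ l 3) i)) n ⟩
  (poly k ^ 2 * poly l ^ 3 * poly m) n ∎
  where
  open ≡-Reasoning
  k = 1 ∷ -1 ∷ []
  l = 1 ∷ -4 ∷ 2 ∷ []
  m = 1 ∷ -3 ∷ -1 ∷ -1 ∷ []

areaSurd-irr : poly (irr areaSurd) * √ poly Δ ≗ - (c * √ poly Δ)
areaSurd-irr n = trans (*-congʳ {poly (irr areaSurd)} (√ poly Δ) (poly-⊖ cₗ) n)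
  (sym (-‿distribˡ-* c (√ poly Δ) n))
  where open RingProperties (CommutativeRing.ring seriesRing) using (-‿distribˡ-*)

theorem4p1 : V ≗ (b - c * √ poly (1 ∷ -4 ∷ 2 ∷ 0 ∷ 1 ∷ []))
    ÷ (poly (1 ∷ -1 ∷ []) ^ 2
    * poly (1 ∷ -4 ∷ 2 ∷ []) ^ 3
    * poly (1 ∷ -3 ∷ -1 ∷ -1 ∷ []))
theorem4p1 = ÷-unique V d (b - c * √ poly Δ) λ n → begin
  (V * d) n                                                ≡⟨ *-comm V d n ⟩
  (d * V) n                                                ≡⟨ *-cong {d} (sym ∘ areaSurd-den) V≗total n ⟩
  (poly (den areaSurd) * total (nonempty all)) n           ≡⟨ _≋_.equation area-≋ n ⟩
  b n ℚ.+ (poly (irr areaSurd) * √ poly Δ) n               ≡⟨ cong (b n ℚ.+_) (areaSurd-irr n) ⟩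
  (b - c * √ poly Δ) n                                     ∎
  where
  open ≡-Reasoning
  d = poly (1 ∷ -1 ∷ []) ^ 2 * poly (1 ∷ -4 ∷ 2 ∷ []) ^ 3 * poly (1 ∷ -3 ∷ -1 ∷ -1 ∷ [])
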